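{- Let $\mathcal{A}$ be a finite alphabet and let $\Theta:\mathcal{A}^*\to\mathcal{A}^*$ be an involutive antimorphism. Let $\mathbf{u}\in\mathcal{A}^{\mathbb{N}}$ be a uniformly recurrent infinite word such that $D_{\Theta}(\mathbf{u})<+\infty$. Then there exist a finite alphabet $\mathcal{B}$, a morphism $\varphi:\mathcal{B}^*\to\mathcal{A}^*$ and a uniformly recurrent infinite word $\mathbf{v}\in\mathcal{B}^{\mathbb{N}}$ such that $\mathbf{u}=\varphi(\mathbf{v})$ and $\mathbf{v}$ is $\Theta_0$-rich, where $\Theta_0$ denotes the reversal mapping on $\mathcal{B}^*$.
   Context: An involutive antimorphism on $\mathcal{A}^*$ is a map $\Theta:\mathcal{A}^*\to\mathcal{A}^*$ with $\Theta^2=\mathrm{Id}$ and $\Theta(uv)=\Theta(v)\Theta(u)$ for all $u,v$. The reversal mapping $\Theta_0$ sends $w_1w_2\cdots w_n$ to $w_nw_{n-1}\cdots w_1$. A word $w$ is a $\Theta$-palindrome if $\Theta(w)=w$ (the empty word is one). For a finite word $w$, $\mathrm{Pal}_\Theta(w)$ is the set of distinct $\Theta$-palindromes occurring as factors of $w$ (including the empty word), and $G_\Theta(w)$ is the number of sets $\{a,\Theta(a)\}$ where $a$ is a letter occurring in $w$ with $a\neq\Theta(a)$. The $\Theta$-palindromic defect of a finite word $w$ is $D_\Theta(w)=|w|+1-G_\Theta(w)-\#\mathrm{Pal}_\Theta(w)$, and for an infinite word $\mathbf{u}$, $D_\Theta(\mathbf{u})=\sup\{D_\Theta(w): w \text{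 a factor of } \mathbf{u}\}$. A finite word $w$ is $\Theta$-rich if $D_\Theta(w)=0$; an infinite word is $\Theta$-rich if all its factors are $\Theta$-rich (for $\Theta_0$ this is the usual notion of a rich word: each factor $w$ contains $|w|+1$ distinct palindromes). An infinite word is recurrent if every factor occurs infinitely often; it is uniformly recurrent if it is recurrent and every factor $w$ has only finitely many return words, i.e. finitely many factors $q$ such that $qw$ has $w$ as prefix and suffix and contains exactly two occurrences of $w$. -}

module Defs where

open import Algebra.Definitions using (Involutive)
open import Algebra.Morphism.Structures using (module MonoidMorphisms)
open import Data.Fin.Base using (Fin)
import Data.Fin.Properties as Fin
open import Data.Integer.Base as ℤ using (ℤ; +_; 0ℤ)
open import Data.List.Base
  using (List; [_]; _++_; length; filter; concatMap; inits; tails;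
         deduplicate; applyUpTo; ++-[]-rawMonoid)
open import Data.List.Membership.Propositional using (_∈_)
open import Data.List.Properties using (≡-dec)
open import Data.List.Relation.Binary.Prefix.Heterogeneous using (Prefix)
open import Data.List.Relation.Binary.Prefix.Heterogeneous.Properties using (prefix?)
open import Data.List.Relation.Binary.Suffix.Heterogeneous using (Suffix)
open import Data.Nat.Base as ℕ using (ℕ)
open import Data.Product.Base using (∃-syntax; _×_)
open import Data.Sum.Base using (_⊎_)
open import Function.Bundles using (_↔_; _⇔_)
open import Function.Properties.Inverse using (↔⇒↣)
open import Relation.Binary.Definitions using (Decidable; DecidableEquality)
open import Relation.Binary.PropositionalEquality using (_≡_)
open import Relation.Nullary.Decidable using (via-injection; ¬?; _⊎-dec_)

record FiniteAlphabet : Set₁ where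
  field
    Letter : Set
    size   : ℕ
    enum   : Letter ↔ Fin size

  infix 4 _≟_ _≟ʷ_

  _≟_ : DecidableEquality Letter
  _≟_ = via-injection (↔⇒↣ enum) Fin._≟_

  Word : Set
  Word = List Letter

  _≟ʷ_ : DecidableEquality Word
  _≟ʷ_ = ≡-dec _≟_

  InfiniteWord : Set
  InfiniteWord = ℕ → Letter

open FiniteAlphabet public using (Letter; Word; InfiniteWord)

-- Finiteness of a set as the existence of an exact listing of its elements.
Finite : {X : Set} → (X → Set) → Set
Finite {X} P = ∃[ xs ] (∀ (x : X) → P x ⇔ x ∈ xs)

IsMorphism : (B A : FiniteAlphabet) → (Word B → Word A) → Set
IsMorphism B A = IsMonoidHomomorphism
  where
  open MonoidMorphisms (++-[]-rawMonoid (Letter B)) (++-[]-rawMonoid (Letter A))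

module _ (A : FiniteAlphabet) where
  open FiniteAlphabet A using (_≟_; _≟ʷ_)

  record IsInvolutiveAntimorphism (Θ : Word A → Word A) : Set where
    field
      involutive : Involutive _≡_ Θ
      anti       : ∀ u v → Θ (u ++ v) ≡ Θ v ++ Θ u

  -- The word u i, u (i + 1), …, u (i + n - 1).
  slice : InfiniteWord A → ℕ → ℕ → Word A
  slice u i n = applyUpTo (λ k → u (i ℕ.+ k)) n

  OccursAt : InfiniteWord A → Word A → ℕ → Set
  OccursAt u w i = slice u i (length w) ≡ w

  IsFactor : InfiniteWord A → Word A → Set
  IsFactor u w = ∃[ i ] OccursAt u w i

  occurrences : Word A → Word A → ℕ
  occurrences w x = length (filter (prefix? _≟_ w) (tails x))

  IsReturnWord : InfiniteWord A → Word A → Word A → Set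
  IsReturnWord u w q =
    IsFactor u (q ++ w) ×
    Prefix _≡_ w (q ++ w) ×
    Suffix _≡_ w (q ++ w) ×
    occurrences w (q ++ w) ≡ 2

  Recurrent : InfiniteWord A → Set
  Recurrent u = ∀ w → IsFactor u w → ∀ n → ∃[ i ] (n ℕ.≤ i × OccursAt u w i)

  UniformlyRecurrent : InfiniteWord A → Set
  UniformlyRecurrent u =
    Recurrent u × (∀ w → IsFactor u w → Finite (IsReturnWord u w))

  -- All factors of a finite word, with repetitions.
  factors : Word A → List (Word A)
  factors w = concatMap inits (tails w)

  module _ (Θ : Word A → Word A) where

    IsPalindrome : Word A → Set
    IsPalindrome w = Θ w ≡ w

    Pal : Word A → List (Word A)
    Pal w = filter (λ x → Θ x ≟ʷ x) (deduplicate _≟ʷ_ (factors w))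

    -- For an involutive antimorphism Θ, which maps letters to letters, this
    -- says {a, Θ(a)} = {b, Θ(b)}.
    SamePair : Letter A → Letter A → Set
    SamePair a b = [ a ] ≡ [ b ] ⊎ [ a ] ≡ Θ [ b ]

    samePair? : Decidable SamePair
    samePair? a b = ([ a ] ≟ʷ [ b ]) ⊎-dec ([ a ] ≟ʷ Θ [ b ])

    G : Word A → ℕ
    G w = length (deduplicate samePair? (filter (λ a → ¬? ([ a ] ≟ʷ Θ [ a ])) w))

    -- Valued in ℤ, so that no truncated subtraction hides a negative value.
    defect : Word A → ℤ
    defect w = + length w ℤ.+ + 1 ℤ.- + G w ℤ.- + length (Pal w)

    -- d = sup { defect w : w a factor of u }.  The second component is the
    -- constructive form of "least upper bound": every smaller number is
    -- exceeded.
    IsDefect : InfiniteWord A → ℤ → Set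
    IsDefect u d =
      (∀ w → IsFactor u w → defect w ℤ.≤ d) ×
      (∀ e → e ℤ.< d → ∃[ w ] (IsFactor u w × e ℤ.< defect w))

    FiniteDefect : InfiniteWord A → Set
    FiniteDefect u = ∃[ d ] IsDefect u d

    Rich : Word A → Set
    Rich w = defect w ≡ 0ℤ

    RichInfinite : InfiniteWord A → Set
    RichInfinite u = ∀ w → IsFactor u w → Rich w

-- u = φ(v): the images of the prefixes of v are prefixes of u, and their
-- lengths are unbounded, so that φ(v) is an infinite word (φ may erase letters).
IsImage : (B A : FiniteAlphabet) →
          (Word B → Word A) → InfiniteWord B → InfiniteWord A → Set
IsImage B A φ v u =
  (∀ n → OccursAt A u (φ (slice B v 0 n)) 0) ×
  (∀ m → ∃[ n ] (m ℕ.≤ length (φ (slice B v 0 n))))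

{-# OPTIONS --safe #-}

-- Extending a word on either side never lowers its defect, so every factor of u
-- that contains a factor w₀ of maximal defect has this maximal defect too.  Hence
-- a letter a appended to such a factor in u creates a new palindrome, a
-- palindromic suffix with no earlier occurrence, once a or Θ(a) is in it.  Take a prefix w of u such that both w and Θ(w) contain w₀, and cut
-- u at all occurrences of w and Θ(w).  The word from one such occurrence to the
-- end of a later one has a unioccurrent palindromic suffix, which is at least as
-- long as w and hence begins at an occurrence of w or Θ(w).  So the word between
-- two consecutive occurrences (ends included) is a palindrome.  Therefore, when u
-- is coded by these blocks, Θ-palindromes of u that begin and end at occurrences
-- become ordinary palindromes of the code v, and every nonempty factor of v has a
-- unioccurrent palindromic suffix; this is richness of v.
module Submission where

open import Defs
open import Data.Fin.Base using (Fin; toℕ; fromℕ<)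
import Data.Fin.Properties as Fin
open import Data.Integer.Base as ℤ using () renaming (+_ to int)
import Data.Integer.Properties as ℤ
import Data.Integer.Tactic.RingSolver as ℤ
open import Data.List.Base hiding (_─_; find)
open import Data.List.Membership.Propositional using (_∈_; find)
open import Data.List.Membership.Propositional.Properties
open import Data.List.Properties
import Data.List.Relation.Binary.Pointwise as Pointwise
open import Data.List.Relation.Binary.Prefix.Heterogeneous using (Prefix; []; _∷_)
open import Data.List.Relation.Binary.Prefix.Heterogeneous.Properties using (prefix?)
open import Data.List.Relation.Binary.Suffix.Heterogeneous as Suffix using (_++ˢ_)
open import Data.List.Relation.Binary.Suffix.Heterogeneous.Properties using (suffix?)
open import Data.List.Relation.Unary.All as All using (All; []; _∷_)
open import Data.List.Relation.Unary.AllPairs using (AllPairs; []; _∷_)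
import Data.List.Relation.Unary.AllPairs.Properties as AllPairs
open import Data.List.Relation.Unary.Any as Any using (Any; here; there; _─_)
import Data.List.Relation.Unary.Any.Properties as Any
import Data.List.Relation.Unary.Unique.DecSetoid.Properties as Unique
open import Data.Nat.Base
  using (ℕ; zero; suc; _+_; _*_; _∸_; _≤_; _<_; z≤n; s≤s; s≤s⁻¹; _⊔_)
import Data.Nat.Properties as ℕ
open import Data.Nat.Properties hiding (_≟_)
open import Data.Nat.Tactic.RingSolver using (solve-∀)
open import Data.Product.Base
  using (Σ-syntax; ∃-syntax; ∃; ∃₂; _×_; _,_; proj₁; proj₂)
open import Data.Sum.Base using (_⊎_; inj₁; inj₂; [_,_]′)
open import Function.Base using (_∘_; flip; case_of_)
open import Function.Bundles using (mk⇔; Equivalence)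
open import Function.Properties.Inverse using (↔-refl)
open import Relation.Binary.Bundles using (DecSetoid)
open import Relation.Binary.Definitions using (tri<; tri≈; tri>)
open import Relation.Binary.PropositionalEquality hiding ([_])
open import Relation.Nullary using (¬_; Dec; yes; no; contradiction; ¬?)
open import Relation.Nullary.Decidable using (_×-dec_; _⊎-dec_; map′)

-- Why both `w` and `Θ w` are cut at: reflection in a Θ-palindrome exchanges their occurrences, so
-- the set of cuts is closed under it, and palindromes of `u` can be followed cut by cut. The
-- proviso that a or Θ(a) is already present costs nothing at a cut: the letter appended last ends a
-- copy of `w` or `Θ w`, and the copy at the starting cut contains it up to Θ. A code letter stands
-- for a block together with the whole mark that follows it, although `φ` maps it only to the part
-- before that mark. This overlap is what allows equality and reflection to be passed from words of
-- `u` to their codes and back, one block at a time. Factors of `u` are handled as a position and a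
-- length, since unioccurrence compares occurrences and not just words. Uniform recurrence is
-- exchanged for an equivalent condition on windows, which passes from `u` to `v` and turns the
-- search for a factor into a bounded one.

infix 4 _⊑_

_⊑_ : {X : Set} → List X → List X → Set
x ⊑ w = ∃₂ λ p q → w ≡ p ++ x ++ q

-- Factors, prefixes and suffixes of lists

module _ {X : Set} where

  ++-split : (p q : List X) {x y : List X} →
             length p ≡ length q → p ++ x ≡ q ++ y → p ≡ q × x ≡ y
  ++-split []      []      _ e = refl , e
  ++-split (_ ∷ p) (_ ∷ q) l e with ++-split p q (suc-injective l) (∷-injectiveʳ e)
  ... | p≡q , x≡y = cong₂ _∷_ (∷-injectiveˡ e) p≡q , x≡y

  ++-compare : (x y : List X) {q r : List X} → x ++ q ≡ y ++ r →
               (∃[ t ] y ≡ x ++ t) ⊎ (∃[ t ] x ≡ y ++ t)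
  ++-compare []      y       _ = inj₁ (y , refl)
  ++-compare (a ∷ x) []      _ = inj₂ (a ∷ x , refl)
  ++-compare (a ∷ x) (b ∷ y) e with ∷-injectiveˡ e | ++-compare x y (∷-injectiveʳ e)
  ... | refl | inj₁ (t , f) = inj₁ (t , cong (a ∷_) f)
  ... | refl | inj₂ (t , f) = inj₂ (t , cong (a ∷_) f)

  length≡0 : (x : List X) → length x ≡ 0 → x ≡ []
  length≡0 [] _ = refl

  []⊑ : (w : List X) → [] ⊑ w
  []⊑ w = [] , w , refl

  ⊑-trans : {x y z : List X} → x ⊑ y → y ⊑ z → x ⊑ z
  ⊑-trans {x} (p , q , refl) (p′ , q′ , refl) = p′ ++ p , q ++ q′ , (begin
    p′ ++ (p ++ x ++ q) ++ q′   ≡⟨ cong (p′ ++_) (++-assoc p (x ++ q) q′) ⟩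
    p′ ++ p ++ (x ++ q) ++ q′   ≡⟨ cong (λ z → p′ ++ p ++ z) (++-assoc x q q′) ⟩
    p′ ++ p ++ x ++ q ++ q′     ≡⟨ ++-assoc p′ p _ ⟨
    (p′ ++ p) ++ x ++ q ++ q′   ∎)
    where open ≡-Reasoning

  new-prefix : {a : X} {x g : List X} → x ⊑ (a ∷ g) → ¬ x ⊑ g → ∃[ q ] a ∷ g ≡ x ++ q
  new-prefix ([]    , q , e) _   = q , e
  new-prefix (b ∷ p , q , e) x⋢g = contradiction (p , q , ∷-injectiveʳ e) x⋢g

  new-suffix : (g : List X) {a : X} {x p q : List X} → g ++ [ a ] ≡ p ++ x ++ q →
               ¬ x ⊑ g → q ≡ []
  new-suffix g {a} {x} {p} {q} e x⋢g with initLast q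
  ... | []      = refl
  ... | q′ ∷ʳ′ b = contradiction (p , q′ , ∷ʳ-injectiveˡ g (p ++ x ++ q′) (trans e (begin
    p ++ x ++ (q′ ++ [ b ])   ≡⟨ cong (p ++_) (++-assoc x q′ [ b ]) ⟨
    p ++ (x ++ q′) ++ [ b ]   ≡⟨ ++-assoc p (x ++ q′) [ b ] ⟨
    (p ++ x ++ q′) ++ [ b ]   ∎))) x⋢g
    where open ≡-Reasoning

  ∷ʳ-last : (y : List X) {a b : X} {s : List X} → y ++ [ b ] ≡ a ∷ s → b ≡ a ⊎ b ∈ s
  ∷ʳ-last []      e = inj₁ (∷-injectiveˡ e)
  ∷ʳ-last (_ ∷ y) e = inj₂ (subst (_ ∈_) (∷-injectiveʳ e) (∈-++⁺ʳ y (here refl)))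

  ∈-inits⁺ : (x q : List X) → x ∈ inits (x ++ q)
  ∈-inits⁺ []      q = here refl
  ∈-inits⁺ (a ∷ x) q = there (∈-map⁺ (a ∷_) (∈-inits⁺ x q))

  ∈-inits⁻ : {x : List X} (w : List X) → x ∈ inits w → ∃[ q ] w ≡ x ++ q
  ∈-inits⁻ w       (here refl) = w , refl
  ∈-inits⁻ (a ∷ w) (there x∈)  with ∈-map⁻ (a ∷_) x∈
  ... | y , y∈ , refl with ∈-inits⁻ w y∈
  ... | q , refl = q , refl

  ∈-tails⁺ : (p x : List X) → x ∈ tails (p ++ x)
  ∈-tails⁺ []      x = here refl
  ∈-tails⁺ (_ ∷ p) x = there (∈-tails⁺ p x)

  ∈-tails⁻ : {x : List X} (w : List X) → x ∈ tails w → ∃[ p ] w ≡ p ++ x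
  ∈-tails⁻ w       (here refl) = [] , refl
  ∈-tails⁻ (a ∷ w) (there x∈)  with ∈-tails⁻ w x∈
  ... | p , refl = a ∷ p , refl

-- Counting up to an equivalence

module _ {X : Set} (R : X → X → Set)
         (R-sym : ∀ {x y} → R x y → R y x)
         (R-trans : ∀ {x y z} → R x y → R y z → R x z) where

  remove : ∀ {x y ys} (p : Any (R x) ys) → Any (R y) ys → ¬ R x y → Any (R y) (ys ─ p)
  remove (here xz)  (here yz)  x≁y = contradiction (R-trans xz (R-sym yz)) x≁y
  remove (here xz)  (there q)  _   = q
  remove (there p)  (here yz)  _   = here yz
  remove (there p)  (there q)  x≁y = there (remove p q x≁y)

  -- Pigeonhole: each `x` uses up its representative in `ys`, and by `remove` the later elements,
  -- inequivalent to `x`, keep theirs. Used for palindromes with equality and for letters with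
  -- `Pair`.
  length-mono : ∀ {xs ys} → AllPairs (λ x y → ¬ R x y) xs → All (λ x → Any (R x) ys) xs →
                length xs ≤ length ys
  length-mono []         []         = z≤n
  length-mono {ys = ys} (x≁ ∷ xs!) (x∈ ∷ xs∈) = ≤-trans
    (s≤s (length-mono xs! (All.zipWith (λ (x≁y , y∈) → remove x∈ y∈ x≁y) (x≁ , xs∈))))
    (≤-reflexive (sym (length-removeAt′ ys (Any.index x∈))))

-- Defect of finite words

module Palindromes (A : FiniteAlphabet) (Θ : Word A → Word A)
                   (Θ-anti : IsInvolutiveAntimorphism A Θ) where

  open FiniteAlphabet A using (_≟_; _≟ʷ_)
  open IsInvolutiveAntimorphism Θ-anti

  ∈-factors⁺ : {x w : Word A} → x ⊑ w → x ∈ factors A w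
  ∈-factors⁺ {x} (p , q , refl) =
    ∈-concatMap⁺ inits (Any.map (λ { refl → ∈-inits⁺ x q }) (∈-tails⁺ p (x ++ q)))

  ∈-factors⁻ : {x : Word A} (w : Word A) → x ∈ factors A w → x ⊑ w
  ∈-factors⁻ w x∈ with find (∈-concatMap⁻ inits {xs = tails w} x∈)
  ... | t , t∈ , x∈ with ∈-tails⁻ w t∈ | ∈-inits⁻ t x∈
  ... | p , refl | q , refl = p , q , refl

  Θ-[] : Θ [] ≡ []
  Θ-[] = length≡0 _ (sym (+-cancelˡ-≡ (length (Θ [])) _ _
    (trans (+-identityʳ _) (trans (cong length (anti [] [])) (length-++ (Θ []))))))

  -- Preservation of length is not part of the definition of an antimorphism. An involution fixing
  -- the empty word cannot erase a letter, so lengths never drop; applied to `Θ w` as well, this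
  -- gives equality.
  length-Θ-≤ : ∀ w → length w ≤ length (Θ w)
  length-Θ-≤ []      = z≤n
  length-Θ-≤ (a ∷ w) with Θ [ a ] in eq
  ... | []    = contradiction (trans (sym (involutive [ a ])) (trans (cong Θ eq) Θ-[])) λ ()
  ... | b ∷ t = begin
    suc (length w)                       ≤⟨ s≤s (length-Θ-≤ w) ⟩
    1 + length (Θ w)                     ≤⟨ +-monoˡ-≤ (length (Θ w)) (s≤s z≤n) ⟩
    length (b ∷ t) + length (Θ w)        ≡⟨ +-comm (length (b ∷ t)) _ ⟩
    length (Θ w) + length (b ∷ t)        ≡⟨ length-++ (Θ w) ⟨
    length (Θ w ++ b ∷ t)                ≡⟨ cong (λ z → length (Θ w ++ z)) eq ⟨
    length (Θ w ++ Θ [ a ])              ≡⟨ cong length (anti [ a ] w) ⟨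
    length (Θ (a ∷ w))                   ∎
    where open ≤-Reasoning

  length-Θ : ∀ w → length (Θ w) ≡ length w
  length-Θ w = ≤-antisym
    (≤-trans (length-Θ-≤ (Θ w)) (≤-reflexive (cong length (involutive w)))) (length-Θ-≤ w)

  Θ-letter : ∀ a → ∃[ b ] Θ [ a ] ≡ [ b ]
  Θ-letter a with Θ [ a ] | length-Θ [ a ]
  ... | b ∷ [] | refl = b , refl

  Θ-⊑ : ∀ {x w} → x ⊑ w → Θ x ⊑ Θ w
  Θ-⊑ {x} (p , q , refl) = Θ q , Θ p , (begin
    Θ (p ++ x ++ q)       ≡⟨ anti p (x ++ q) ⟩
    Θ (x ++ q) ++ Θ p     ≡⟨ cong (_++ Θ p) (anti x q) ⟩
    (Θ q ++ Θ x) ++ Θ p   ≡⟨ ++-assoc (Θ q) (Θ x) (Θ p) ⟩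
    Θ q ++ Θ x ++ Θ p     ∎)
    where open ≡-Reasoning

  Pair : Letter A → Letter A → Set
  Pair = SamePair A Θ

  pair-sym : ∀ {a b} → Pair a b → Pair b a
  pair-sym (inj₁ e) = inj₁ (sym e)
  pair-sym (inj₂ e) = inj₂ (trans (sym (involutive _)) (cong Θ (sym e)))

  pair-trans : ∀ {a b c} → Pair a b → Pair b c → Pair a c
  pair-trans (inj₁ e) (inj₁ f) = inj₁ (trans e f)
  pair-trans (inj₁ e) (inj₂ f) = inj₂ (trans e f)
  pair-trans (inj₂ e) (inj₁ f) = inj₂ (trans e (cong Θ f))
  pair-trans (inj₂ e) (inj₂ f) = inj₁ (trans e (trans (cong Θ f) (involutive _)))

  pairDecSetoid : DecSetoid _ _
  pairDecSetoid = record
    { Carrier = Letter A ; _≈_ = Pair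
    ; isDecEquivalence = record
      { isEquivalence = record { refl = inj₁ refl ; sym = pair-sym ; trans = pair-trans }
      ; _≟_ = samePair? A Θ } }

  Fixed : Letter A → Set
  Fixed a = [ a ] ≡ Θ [ a ]

  pair-fixed : ∀ {a b} → Pair a b → Fixed a → Fixed b
  pair-fixed (inj₁ refl) f = f
  pair-fixed (inj₂ e)    f = trans (sym (involutive _)) (trans (cong Θ (trans (sym e) f))
    (trans (involutive _) e))

  moved : Word A → List (Letter A)
  moved = filter (λ a → ¬? ([ a ] ≟ʷ Θ [ a ]))

  classes : Word A → List (Letter A)
  classes w = deduplicate (samePair? A Θ) (moved w)

  classes! : ∀ w → AllPairs (λ a b → ¬ Pair a b) (classes w)
  classes! w = Unique.deduplicate-! pairDecSetoid (moved w)

  ∈-classes⁺ : ∀ {a b w} → b ∈ w → ¬ Fixed b → Pair a b → Any (Pair a) (classes w)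
  ∈-classes⁺ b∈ ¬f ab = Any.deduplicate⁺ (samePair? A Θ) (λ yz ay → pair-trans ay (pair-sym yz))
    (Any.map (λ { refl → ab }) (∈-filter⁺ _ b∈ ¬f))

  ∈-classes⁻ : ∀ {a} w → a ∈ classes w → a ∈ w × ¬ Fixed a
  ∈-classes⁻ w a∈ = ∈-filter⁻ _ (∈-deduplicate⁻ (samePair? A Θ) (moved w) a∈)

  ∈-Pal⁺ : ∀ {x w} → Θ x ≡ x → x ⊑ w → x ∈ Pal A Θ w
  ∈-Pal⁺ pal x⊑ = ∈-filter⁺ (λ x → Θ x ≟ʷ x) (∈-deduplicate⁺ _≟ʷ_ (∈-factors⁺ x⊑)) pal

  ∈-Pal⁻ : ∀ {x} w → x ∈ Pal A Θ w → Θ x ≡ x × x ⊑ w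
  ∈-Pal⁻ w x∈ with ∈-filter⁻ (λ x → Θ x ≟ʷ x) {xs = deduplicate _≟ʷ_ (factors A w)} x∈
  ... | x∈f , pal = pal , ∈-factors⁻ w (∈-deduplicate⁻ _≟ʷ_ (factors A w) x∈f)

  wordDecSetoid : DecSetoid _ _
  wordDecSetoid = record
    { Carrier = Word A ; _≈_ = _≡_
    ; isDecEquivalence = record { isEquivalence = isEquivalence ; _≟_ = _≟ʷ_ } }

  Pal! : ∀ w → AllPairs _≢_ (Pal A Θ w)
  Pal! w = AllPairs.filter⁺ (λ x → Θ x ≟ʷ x) (Unique.deduplicate-! wordDecSetoid (factors A w))

  -- The quantity subtracted in the defect, kept in ℕ: the effect of one more letter on the defect
  -- is read off from whether the rank grows by one.
  rank : Word A → ℕ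
  rank w = G A Θ w + length (Pal A Θ w)

  NewPal : Word A → Word A → Word A → Set
  NewPal g f x = Θ x ≡ x × x ⊑ f × ¬ x ⊑ g

  newPal? : ∀ g f → (∃ (NewPal g f)) ⊎ (∀ {x} → Θ x ≡ x → x ⊑ f → x ⊑ g)
  newPal? g f with Any.any? (λ x → ¬? (Any.any? (x ≟ʷ_) (Pal A Θ g))) (Pal A Θ f)
  ... | yes any = inj₁ (search any)
    where
    search′ : ∀ {xs} → (∀ {x} → x ∈ xs → Θ x ≡ x × x ⊑ f) → Any (λ x → ¬ x ∈ Pal A Θ g) xs →
              ∃ (NewPal g f)
    search′ h (here x∉)  with h (here refl)
    ... | pal , x⊑f = _ , pal , x⊑f , λ x⊑g → x∉ (∈-Pal⁺ pal x⊑g)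
    search′ h (there x∉) = search′ (h ∘ there) x∉
    search : Any (λ x → ¬ x ∈ Pal A Θ g) (Pal A Θ f) → ∃ (NewPal g f)
    search = search′ (∈-Pal⁻ f)
  ... | no ¬any = inj₂ λ {x} pal x⊑f → case Any.any? (x ≟ʷ_) (Pal A Θ g) of λ where
    (yes x∈) → proj₂ (∈-Pal⁻ g x∈)
    (no x∉)  → contradiction (Any.map (λ { refl → x∉ }) (∈-Pal⁺ pal x⊑f)) ¬any

  Pal-≤ : ∀ g f → (∀ {x} → Θ x ≡ x → x ⊑ f → x ⊑ g) → length (Pal A Θ f) ≤ length (Pal A Θ g)
  Pal-≤ g f h = length-mono _≡_ sym trans (Pal! f) (All.tabulate λ x∈ →
    let pal , x⊑ = ∈-Pal⁻ f x∈ in ∈-Pal⁺ pal (h pal x⊑))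

  G-≤ : ∀ g f → (∀ {a} → a ∈ f → ¬ Fixed a → Any (Pair a) g) → G A Θ f ≤ G A Θ g
  G-≤ g f h = length-mono Pair pair-sym pair-trans (classes! f) (All.tabulate λ {a} a∈ →
    let a∈f , ¬fix = ∈-classes⁻ f a∈ in go a∈f ¬fix (h a∈f ¬fix))
    where
    go : ∀ {a w} → a ∈ f → ¬ Fixed a → Any (Pair a) w → Any (Pair a) (classes w)
    go {w = w} a∈ ¬fix any with find any
    ... | b , b∈ , ab = ∈-classes⁺ b∈ (¬fix ∘ pair-fixed (pair-sym ab)) ab

  -- f is g with the letter a added at either end.
  module OneStep (g f : Word A) (a : Letter A)
    (new-unique : ∀ {x y} → NewPal g f x → NewPal g f y → x ≡ y)
    (new-letter : ¬ Fixed a → ¬ Any (Pair a) g → ∀ {x} → ¬ NewPal g f x)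
    (letters    : ∀ {b} → b ∈ f → b ∈ g ⊎ b ≡ a) where

    Pal-step : length (Pal A Θ f) ≤ suc (length (Pal A Θ g))
    Pal-step with newPal? g f
    ... | inj₂ h = m≤n⇒m≤1+n (Pal-≤ g f h)
    ... | inj₁ (s , new) = length-mono _≡_ sym trans {ys = s ∷ Pal A Θ g} (Pal! f)
      (All.tabulate λ {x} x∈ → let pal , x⊑f = ∈-Pal⁻ f x∈ in
        case Any.any? (x ≟ʷ_) (Pal A Θ g) of λ where
          (yes x∈g) → there x∈g
          (no x∉g)  → here (new-unique (pal , x⊑f , λ x⊑g → x∉g (∈-Pal⁺ pal x⊑g)) new))

    -- The two summands of the rank cannot both grow. If `a` opens a new class of letters, no
    -- palindrome is new; otherwise `G` does not grow and at most one palindrome is new.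
    rank-step : rank f ≤ suc (rank g)
    rank-step with [ a ] ≟ʷ Θ [ a ] | Any.any? (samePair? A Θ a) g
    ... | no ¬fix | no ∉g = +-mono-≤ G-step (Pal-≤ g f old)
      where
      old : ∀ {x} → Θ x ≡ x → x ⊑ f → x ⊑ g
      old {x} pal x⊑f with newPal? g f
      ... | inj₁ (_ , new) = contradiction new (new-letter ¬fix ∉g)
      ... | inj₂ h = h pal x⊑f
      G-step : G A Θ f ≤ suc (G A Θ g)
      G-step = length-mono Pair pair-sym pair-trans {ys = a ∷ classes g} (classes! f)
        (All.tabulate λ b∈ → let b∈f , ¬fixb = ∈-classes⁻ f b∈ in
          [ (λ b∈g → there (∈-classes⁺ b∈g ¬fixb (inj₁ refl))) , (λ { refl → here (inj₁ refl) }) ]′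
            (letters b∈f))
    ... | yes fix | _ = ≤-trans (+-mono-≤ (G-≤ g f same) Pal-step)
                                (≤-reflexive (+-suc (G A Θ g) _))
      where
      same : ∀ {b} → b ∈ f → ¬ Fixed b → Any (Pair b) g
      same b∈f ¬fixb with letters b∈f
      ... | inj₁ b∈g  = Any.map (λ { refl → inj₁ refl }) b∈g
      ... | inj₂ refl = contradiction fix ¬fixb
    ... | no _ | yes ∈g = ≤-trans (+-mono-≤ (G-≤ g f same) Pal-step)
                                (≤-reflexive (+-suc (G A Θ g) _))
      where
      same : ∀ {b} → b ∈ f → ¬ Fixed b → Any (Pair b) g
      same b∈f ¬fixb with letters b∈f
      ... | inj₁ b∈g  = Any.map (λ { refl → inj₁ refl }) b∈g
      ... | inj₂ refl = ∈g

  -- Both s and t are palindromes, so a prefix s of t is also a suffix of t, and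
  -- lies in g unless s = t.
  pal-prefix : ∀ {a g s t r q} → Θ s ≡ s → Θ t ≡ t → t ≡ s ++ r → a ∷ g ≡ t ++ q → ¬ s ⊑ g → s ≡ t
  pal-prefix {r = []} _ _ refl _ _ = sym (++-identityʳ _)
  pal-prefix {a} {g} {s} {t} {r@(_ ∷ _)} {q} Θs Θt t≡ e s⋢g with Θ r in Θr
  ... | []    = contradiction (trans (sym (length-Θ r)) (cong length Θr)) λ ()
  ... | d ∷ r′ = contradiction (r′ , q , ∷-injectiveʳ (begin
    a ∷ g                ≡⟨ e ⟩
    t ++ q               ≡⟨ cong (_++ q) Θt ⟨
    Θ t ++ q             ≡⟨ cong (λ z → Θ z ++ q) t≡ ⟩
    Θ (s ++ r) ++ q      ≡⟨ cong (_++ q) (anti s r) ⟩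
    (Θ r ++ Θ s) ++ q    ≡⟨ cong₂ (λ y z → (y ++ z) ++ q) Θr Θs ⟩
    (d ∷ r′ ++ s) ++ q   ≡⟨ cong (d ∷_) (++-assoc r′ s q) ⟩
    d ∷ r′ ++ s ++ q     ∎)) s⋢g
    where open ≡-Reasoning

  newPal-unique-∷ : ∀ {a g s t} → NewPal g (a ∷ g) s → NewPal g (a ∷ g) t → s ≡ t
  newPal-unique-∷ {s = s} {t} (Θs , s⊑ , s⋢) (Θt , t⊑ , t⋢)
    with new-prefix s⊑ s⋢ | new-prefix t⊑ t⋢
  ... | q , e | r , f with ++-compare s t (trans (sym e) f)
  ... | inj₁ (_ , h) = pal-prefix Θs Θt h f s⋢
  ... | inj₂ (_ , h) = sym (pal-prefix Θt Θs h e t⋢)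

  -- A new palindrome is a prefix of `a ∷ g`, so it starts with `a` and ends with the letter Θ(a).
  -- Either the two coincide and `a` is fixed, or Θ(a) lies in `g`.
  newPal-letter-∷ : ∀ {a g} → ¬ Fixed a → ¬ Any (Pair a) g → ∀ {s} → ¬ NewPal g (a ∷ g) s
  newPal-letter-∷ {a} {g} ¬fix ∉g {s} (Θs , s⊑ , s⋢) with new-prefix s⊑ s⋢
  newPal-letter-∷ {g = g} ¬fix ∉g {[]} (Θs , s⊑ , s⋢) | q , e = s⋢ ([]⊑ g)
  newPal-letter-∷ {a} {g} ¬fix ∉g {c ∷ s} (Θs , s⊑ , s⋢) | q , e with ∷-injectiveˡ e
  ... | refl with Θ-letter a
  ... | b , Θa with ∷ʳ-last (Θ s) (trans (cong (Θ s ++_) (sym Θa)) (trans (sym (anti [ a ] s)) Θs))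
  ... | inj₁ refl = ¬fix (sym Θa)
  ... | inj₂ b∈s  = ∉g (subst (Any (Pair a)) (sym (∷-injectiveʳ e))
    (Any.++⁺ˡ (Any.map (λ { refl → inj₂ (trans (sym (involutive _)) (cong Θ Θa)) }) b∈s)))

  rank-∷ : ∀ a g → rank (a ∷ g) ≤ suc (rank g)
  rank-∷ a g = OneStep.rank-step g (a ∷ g) a newPal-unique-∷ newPal-letter-∷
    λ { (here refl) → inj₂ refl ; (there b∈) → inj₁ b∈ }

  -- Reduces appending a letter to prepending one: `Θ` exchanges the two and leaves each palindrome
  -- as it is.
  newPal-Θ : ∀ {a b} g → Θ [ a ] ≡ [ b ] → ∀ {s} → NewPal g (g ++ [ a ]) s → NewPal (Θ g) (b ∷ Θ g) s
  newPal-Θ {a} {b} g Θa {s} (Θs , s⊑ , s⋢) = Θs ,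
    subst₂ _⊑_ Θs (trans (anti g [ a ]) (cong (_++ Θ g) Θa)) (Θ-⊑ s⊑) ,
    λ s⊑Θg → s⋢ (subst₂ _⊑_ Θs (involutive g) (Θ-⊑ s⊑Θg))

  ∈⇒⊑ : ∀ {a} {w : Word A} → a ∈ w → [ a ] ⊑ w
  ∈⇒⊑ a∈ with ∈-∃++ a∈
  ... | p , q , e = p , q , e

  ⊑⇒∈ : ∀ {a} {w : Word A} → [ a ] ⊑ w → a ∈ w
  ⊑⇒∈ {a} (p , q , e) = subst (a ∈_) (sym e) (∈-++⁺ʳ p (here refl))

  newPal-unique-∷ʳ : ∀ {a} g {s t} → NewPal g (g ++ [ a ]) s → NewPal g (g ++ [ a ]) t → s ≡ t
  newPal-unique-∷ʳ {a} g ns nt = let b , Θa = Θ-letter a in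
    newPal-unique-∷ (newPal-Θ g Θa ns) (newPal-Θ g Θa nt)

  newPal-letter-∷ʳ : ∀ {a} g → ¬ Fixed a → ¬ Any (Pair a) g → ∀ {s} → ¬ NewPal g (g ++ [ a ]) s
  newPal-letter-∷ʳ {a} g ¬fix ∉g ns with Θ-letter a
  ... | b , Θa = newPal-letter-∷
    (λ fix → ¬fix (pair-fixed b~a fix))
    (λ any → let c , c∈ , bc = find any
                 d , Θc = Θ-letter c
                 ac : Pair a c
                 ac = pair-trans (pair-sym b~a) bc
                 d∈ : d ∈ g
                 d∈ = ⊑⇒∈ (subst₂ _⊑_ Θc (involutive g) (Θ-⊑ (∈⇒⊑ c∈)))
             in ∉g (Any.map (λ { refl → pair-trans ac (inj₂ (c≡Θd Θc)) }) d∈))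
    (newPal-Θ g Θa ns)
    where
    c≡Θd : ∀ {c d} → Θ [ c ] ≡ [ d ] → [ c ] ≡ Θ [ d ]
    c≡Θd e = trans (sym (involutive _)) (cong Θ e)
    b~a : Pair b a
    b~a = inj₂ (sym Θa)

  rank-∷ʳ : ∀ g a → rank (g ++ [ a ]) ≤ suc (rank g)
  rank-∷ʳ g a = OneStep.rank-step g (g ++ [ a ]) a (newPal-unique-∷ʳ g) (newPal-letter-∷ʳ g)
    λ b∈ → case ∈-++⁻ g b∈ of λ { (inj₁ b∈g) → inj₁ b∈g ; (inj₂ (here refl)) → inj₂ refl }

  defect-rank : ∀ w → defect A Θ w ℤ.+ int (rank w) ≡ int (suc (length w))
  defect-rank w = trans (lemma (int (length w)) (int (G A Θ w)) (int (length (Pal A Θ w))))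
                        (cong int (+-comm (length w) 1))
    where
    lemma : ∀ l g p → l ℤ.+ int 1 ℤ.- g ℤ.- p ℤ.+ (g ℤ.+ p) ≡ l ℤ.+ int 1
    lemma = ℤ.solve-∀

  module _ (g f : Word A) (len : length f ≡ suc (length g)) where

    -- Defect plus rank is the length plus one, so one extra letter is shared between them: the
    -- defect stays put exactly when the rank takes it.
    defect-balance : defect A Θ f ℤ.+ int (rank f) ≡ defect A Θ g ℤ.+ int (suc (rank g))
    defect-balance = begin
      defect A Θ f ℤ.+ int (rank f)              ≡⟨ defect-rank f ⟩
      int (suc (length f))                       ≡⟨ cong (λ n → int (suc n)) len ⟩
      int 1 ℤ.+ int (suc (length g))               ≡⟨ cong (ℤ._+_ (int 1)) (defect-rank g) ⟨
      int 1 ℤ.+ (defect A Θ g ℤ.+ int (rank g))    ≡⟨ lemma (defect A Θ g) (int (rank g)) ⟩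
      defect A Θ g ℤ.+ int (suc (rank g))        ∎
      where
      open ≡-Reasoning
      lemma : ∀ d r → int 1 ℤ.+ (d ℤ.+ r) ≡ d ℤ.+ (int 1 ℤ.+ r)
      lemma = ℤ.solve-∀

    defect-mono : rank f ≤ suc (rank g) → defect A Θ g ℤ.≤ defect A Θ f
    defect-mono r≤ = ℤ.≮⇒≥ λ f<g → ℤ.<-irrefl defect-balance (ℤ.+-mono-<-≤ f<g (ℤ.+≤+ r≤))

    rank-jump : defect A Θ f ℤ.≤ defect A Θ g → suc (rank g) ≤ rank f
    rank-jump f≤g = ≮⇒≥ λ r< → ℤ.<-irrefl defect-balance (ℤ.+-mono-≤-< f≤g (ℤ.+<+ r<))

    rank-jump⁻ : suc (rank g) ≤ rank f → defect A Θ f ℤ.≤ defect A Θ g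
    rank-jump⁻ r≤ = ℤ.≮⇒≥ λ g<f → ℤ.<-irrefl (sym defect-balance) (ℤ.+-mono-<-≤ g<f (ℤ.+≤+ r≤))

  length-snoc : ∀ (g : Word A) a → length (g ++ [ a ]) ≡ suc (length g)
  length-snoc g a = trans (length-++ g) (+-comm (length g) 1)

  defect-∷ : ∀ a g → defect A Θ g ℤ.≤ defect A Θ (a ∷ g)
  defect-∷ a g = defect-mono g (a ∷ g) refl (rank-∷ a g)

  defect-∷ʳ : ∀ g a → defect A Θ g ℤ.≤ defect A Θ (g ++ [ a ])
  defect-∷ʳ g a = defect-mono g (g ++ [ a ]) (length-snoc g a) (rank-∷ʳ g a)

  defect-++ˡ : ∀ p g → defect A Θ g ℤ.≤ defect A Θ (p ++ g)
  defect-++ˡ []      g = ℤ.≤-refl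
  defect-++ˡ (a ∷ p) g = ℤ.≤-trans (defect-++ˡ p g) (defect-∷ a (p ++ g))

  defect-++ʳ : ∀ g q → defect A Θ g ℤ.≤ defect A Θ (g ++ q)
  defect-++ʳ g []      = ℤ.≤-reflexive (cong (defect A Θ) (sym (++-identityʳ g)))
  defect-++ʳ g (a ∷ q) = ℤ.≤-trans (defect-∷ʳ g a)
    (ℤ.≤-trans (defect-++ʳ (g ++ [ a ]) q)
               (ℤ.≤-reflexive (cong (defect A Θ) (++-assoc g [ a ] q))))

  defect-⊑ : ∀ {x w} → x ⊑ w → defect A Θ x ℤ.≤ defect A Θ w
  defect-⊑ {x} (p , q , refl) = ℤ.≤-trans (defect-++ʳ x q) (defect-++ˡ p (x ++ q))

  -- With no new class and no new palindrome the rank would not grow, so the defect would have to.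
  newPal-exists : ∀ g a → defect A Θ (g ++ [ a ]) ℤ.≤ defect A Θ g → Any (Pair a) g →
                  ∃ (NewPal g (g ++ [ a ]))
  newPal-exists g a f≤g a∈ with newPal? g (g ++ [ a ])
  ... | inj₁ new = new
  ... | inj₂ h = contradiction (rank-jump g (g ++ [ a ]) (length-snoc g a) f≤g)
    (<⇒≱ (s≤s (+-mono-≤ (G-≤ g (g ++ [ a ]) same) (Pal-≤ g (g ++ [ a ]) h))))
    where
    same : ∀ {b} → b ∈ g ++ [ a ] → ¬ Fixed b → Any (Pair b) g
    same b∈ _ with ∈-++⁻ g b∈
    ... | inj₁ b∈g         = Any.map (λ { refl → inj₁ refl }) b∈g
    ... | inj₂ (here refl) = a∈

  defect-newPal : ∀ g a {s} → NewPal g (g ++ [ a ]) s → defect A Θ (g ++ [ a ]) ≡ defect A Θ g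
  defect-newPal g a {s} (Θs , s⊑ , s⋢) = ℤ.≤-antisym
    (rank-jump⁻ g f (length-snoc g a) (≤-trans (≤-reflexive (sym (+-suc (G A Θ g) _)))
      (+-mono-≤ (G-≤ f g (λ b∈ _ → Any.map (λ { refl → inj₁ refl }) (∈-++⁺ˡ b∈))) grow)))
    (defect-∷ʳ g a)
    where
    f = g ++ [ a ]
    grow : suc (length (Pal A Θ g)) ≤ length (Pal A Θ f)
    grow = length-mono _≡_ sym trans {xs = s ∷ Pal A Θ g}
      (All.tabulate (λ { x∈ refl → s⋢ (proj₂ (∈-Pal⁻ g x∈)) }) ∷ Pal! g)
      (∈-Pal⁺ Θs s⊑ ∷ All.tabulate λ x∈ → let pal , x⊑g = ∈-Pal⁻ g x∈ in
        ∈-Pal⁺ pal (⊑-trans x⊑g ([] , [ a ] , refl)))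

-- Factors of an infinite word by position and length

≤⇒+ : ∀ {i k} → i ≤ k → ∃[ a ] k ≡ i + a
≤⇒+ {i} {k} i≤k = k ∸ i , sym (m+[n∸m]≡n i≤k)

applyUpTo-cong : {X : Set} {f g : ℕ → X} (n : ℕ) → (∀ {k} → k < n → f k ≡ g k) →
                 applyUpTo f n ≡ applyUpTo g n
applyUpTo-cong zero    _ = refl
applyUpTo-cong (suc n) h = cong₂ _∷_ (h (s≤s z≤n)) (applyUpTo-cong n (h ∘ s≤s))

applyUpTo-injective : {X : Set} {f g : ℕ → X} (n : ℕ) → applyUpTo f n ≡ applyUpTo g n →
                      ∀ {k} → k < n → f k ≡ g k
applyUpTo-injective (suc n) e {zero}  _         = ∷-injectiveˡ e
applyUpTo-injective (suc n) e {suc k} (s≤s k<n) = applyUpTo-injective n (∷-injectiveʳ e) k<n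

shift-last : ∀ i d m → i + (suc d + m) ≡ suc i + d + m
shift-last = solve-∀

shift-end : ∀ i d m → i + suc (suc d + m) ≡ suc i + d + suc m
shift-end = solve-∀

+-mirror : ∀ a l b → b + l + a ≡ a + l + b
+-mirror = solve-∀

module Slices (A : FiniteAlphabet) (u : InfiniteWord A) where

  infix 6 _⟦_⟧
  _⟦_⟧ : ℕ → ℕ → Word A
  i ⟦ n ⟧ = slice A u i n

  slice-length : ∀ i n → length (i ⟦ n ⟧) ≡ n
  slice-length i n = length-applyUpTo _ n

  slice-cong : ∀ {i j n} → (∀ {k} → k < n → u (i + k) ≡ u (j + k)) → i ⟦ n ⟧ ≡ j ⟦ n ⟧
  slice-cong {n = n} = applyUpTo-cong n

  slice-letter : ∀ {i j n} → i ⟦ n ⟧ ≡ j ⟦ n ⟧ → ∀ {k} → k < n → u (i + k) ≡ u (j + k)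
  slice-letter {n = n} = applyUpTo-injective n

  slice-suc : ∀ i n → i ⟦ suc n ⟧ ≡ u i ∷ suc i ⟦ n ⟧
  slice-suc i n = cong₂ _∷_ (cong u (+-identityʳ i))
    (applyUpTo-cong n λ {k} _ → cong u (+-suc i k))

  slice-∷ʳ : ∀ i n → i ⟦ suc n ⟧ ≡ i ⟦ n ⟧ ++ [ u (i + n) ]
  slice-∷ʳ i n = sym (applyUpTo-∷ʳ _ n)

  slice-+ : ∀ i a b → i ⟦ a + b ⟧ ≡ i ⟦ a ⟧ ++ (i + a) ⟦ b ⟧
  slice-+ i zero    b = cong (_⟦ b ⟧) (sym (+-identityʳ i))
  slice-+ i (suc a) b = begin
    i ⟦ suc (a + b) ⟧                     ≡⟨ slice-suc i (a + b) ⟩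
    u i ∷ suc i ⟦ a + b ⟧                 ≡⟨ cong (u i ∷_) (slice-+ (suc i) a b) ⟩
    u i ∷ suc i ⟦ a ⟧ ++ (suc i + a) ⟦ b ⟧
      ≡⟨ cong₂ _++_ (sym (slice-suc i a)) (cong (_⟦ b ⟧) (sym (+-suc i a))) ⟩
    i ⟦ suc a ⟧ ++ (i + suc a) ⟦ b ⟧      ∎
    where open ≡-Reasoning

  slice-+₃ : ∀ i a l b → i ⟦ a + l + b ⟧ ≡ i ⟦ a ⟧ ++ (i + a) ⟦ l ⟧ ++ (i + a + l) ⟦ b ⟧
  slice-+₃ i a l b = begin
    i ⟦ a + l + b ⟧                                   ≡⟨ cong (i ⟦_⟧) (+-assoc a l b) ⟩
    i ⟦ a + (l + b) ⟧                                 ≡⟨ slice-+ i a (l + b) ⟩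
    i ⟦ a ⟧ ++ (i + a) ⟦ l + b ⟧                      ≡⟨ cong (i ⟦ a ⟧ ++_) (slice-+ (i + a) l b) ⟩
    i ⟦ a ⟧ ++ (i + a) ⟦ l ⟧ ++ (i + a + l) ⟦ b ⟧     ∎
    where open ≡-Reasoning

  slice-sub : ∀ {i j n} → i ⟦ n ⟧ ≡ j ⟦ n ⟧ → ∀ a {l} → a + l ≤ n → (i + a) ⟦ l ⟧ ≡ (j + a) ⟦ l ⟧
  slice-sub {i} {j} e a a+l≤n = slice-cong λ {k} k<l → begin
    u (i + a + k)     ≡⟨ cong u (+-assoc i a k) ⟩
    u (i + (a + k))   ≡⟨ slice-letter e (≤-trans (+-monoʳ-< a k<l) a+l≤n) ⟩
    u (j + (a + k))   ≡⟨ cong u (+-assoc j a k) ⟨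
    u (j + a + k)     ∎
    where open ≡-Reasoning

  slice-take : ∀ {i j n l} → i ⟦ n ⟧ ≡ j ⟦ n ⟧ → l ≤ n → i ⟦ l ⟧ ≡ j ⟦ l ⟧
  slice-take {i} {j} e l≤n = slice-cong {i} {j} λ k<l → slice-letter e (≤-trans k<l l≤n)

  slice-⊑ : ∀ {i k l n} → i ≤ k → k + l ≤ i + n → k ⟦ l ⟧ ⊑ i ⟦ n ⟧
  slice-⊑ {i} {k} {l} {n} i≤k k+l≤ with ≤⇒+ i≤k
  ... | a , refl with ≤⇒+ (+-cancelˡ-≤ i (a + l) n (≤-trans (≤-reflexive (sym (+-assoc i a l))) k+l≤))
  ... | b , refl = i ⟦ a ⟧ , (i + a + l) ⟦ b ⟧ , slice-+₃ i a l b

  slice-locate : ∀ i n p {x q} → i ⟦ n ⟧ ≡ p ++ x ++ q →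
                 (i + length p) ⟦ length x ⟧ ≡ x × length p + length x + length q ≡ n
  slice-locate i n p {x} {q} e = loc , sym len
    where
    open ≡-Reasoning
    a = length p
    l = length x
    b = length q
    len : n ≡ a + l + b
    len = begin
      n                        ≡⟨ slice-length i n ⟨
      length (i ⟦ n ⟧)         ≡⟨ cong length e ⟩
      length (p ++ x ++ q)     ≡⟨ length-++ p ⟩
      a + length (x ++ q)      ≡⟨ cong (a +_) (length-++ x) ⟩
      a + (l + b)              ≡⟨ +-assoc a l b ⟨
      a + l + b                ∎
    dec : i ⟦ a ⟧ ++ (i + a) ⟦ l ⟧ ++ (i + a + l) ⟦ b ⟧ ≡ p ++ x ++ q
    dec = trans (sym (slice-+₃ i a l b)) (trans (cong (i ⟦_⟧) (sym len)) e)
    loc : (i + a) ⟦ l ⟧ ≡ x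
    loc = proj₁ (++-split ((i + a) ⟦ l ⟧) x (slice-length (i + a) l)
                  (proj₂ (++-split (i ⟦ a ⟧) p (slice-length i a) dec)))

  ⊑-slice : ∀ {x i n} → x ⊑ i ⟦ n ⟧ → ∃[ a ] a + length x ≤ n × (i + a) ⟦ length x ⟧ ≡ x
  ⊑-slice {x} {i} {n} (p , q , e) with slice-locate i n p e
  ... | loc , len = length p , ≤-trans (m≤m+n _ (length q)) (≤-reflexive len) , loc

  occursAt : ∀ i n → OccursAt A u (i ⟦ n ⟧) i
  occursAt i n = cong (i ⟦_⟧) (slice-length i n)

  isFactor : ∀ i n → IsFactor A u (i ⟦ n ⟧)
  isFactor i n = i , occursAt i n

  -- Reflection of positions and unioccurrent palindromic suffixes

  module Mirror (Θ : Word A → Word A) (Θ-anti : IsInvolutiveAntimorphism A Θ) where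

    open Palindromes A Θ Θ-anti
    open IsInvolutiveAntimorphism Θ-anti

    -- Reflection exchanges `a`, the number of letters before the piece, with `b`, the number after
    -- it. For a palindrome it is used with `j` equal to `i`.
    slice-mirror : ∀ {i j n} → j ⟦ n ⟧ ≡ Θ (i ⟦ n ⟧) → ∀ a l b → a + l + b ≡ n →
                   (j + b) ⟦ l ⟧ ≡ Θ ((i + a) ⟦ l ⟧)
    slice-mirror {i} {j} e a l b refl =
      proj₁ (++-split ((j + b) ⟦ l ⟧) (Θ ((i + a) ⟦ l ⟧))
        (trans (slice-length (j + b) l) (sym (trans (length-Θ _) (slice-length (i + a) l))))
        (proj₂ (++-split (j ⟦ b ⟧) (Θ ((i + a + l) ⟦ b ⟧))
          (trans (slice-length j b) (sym (trans (length-Θ _) (slice-length (i + a + l) b)))) (begin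
        j ⟦ b ⟧ ++ (j + b) ⟦ l ⟧ ++ (j + b + l) ⟦ a ⟧  ≡⟨ slice-+₃ j b l a ⟨
        j ⟦ b + l + a ⟧                                ≡⟨ cong (j ⟦_⟧) (+-mirror a l b) ⟩
        j ⟦ a + l + b ⟧                                ≡⟨ e ⟩
        Θ (i ⟦ a + l + b ⟧)                            ≡⟨ cong Θ (slice-+₃ i a l b) ⟩
        Θ (i ⟦ a ⟧ ++ x ++ y)                          ≡⟨ anti (i ⟦ a ⟧) (x ++ y) ⟩
        Θ (x ++ y) ++ Θ (i ⟦ a ⟧)                      ≡⟨ cong (_++ Θ (i ⟦ a ⟧)) (anti x y) ⟩
        (Θ y ++ Θ x) ++ Θ (i ⟦ a ⟧)                    ≡⟨ ++-assoc (Θ y) (Θ x) _ ⟩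
        Θ y ++ Θ x ++ Θ (i ⟦ a ⟧)                      ∎))))
      where
      open ≡-Reasoning
      x = (i + a) ⟦ l ⟧
      y = (i + a + l) ⟦ b ⟧

    module Maximal (w₀ : Word A)
      (maximal : ∀ x → IsFactor A u x → defect A Θ x ℤ.≤ defect A Θ w₀) where

      -- A unioccurrent palindromic suffix of the word from `i` up to but excluding `e`. Only
      -- earlier starts have to be ruled out, since an occurrence starting later would run past `e`.
      record Ups (i e : ℕ) : Set where
        field
          start len    : ℕ
          i≤start      : i ≤ start
          end          : start + len ≡ e
          palindrome   : Θ (start ⟦ len ⟧) ≡ start ⟦ len ⟧
          unioccurrent : ∀ {k} → i ≤ k → k < start → k ⟦ len ⟧ ≢ start ⟦ len ⟧

      newPal-ups : ∀ i n → ∃ (NewPal (i ⟦ n ⟧) (i ⟦ n ⟧ ++ [ u (i + n) ])) → Ups i (i + suc n)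
      newPal-ups i n (s , Θs , (p , q , e) , s⋢) = record
        { start = i + length p
        ; len = length s
        ; i≤start = m≤m+n i _
        ; end = trans (+-assoc i _ _) (cong (i +_) end≡)
        ; palindrome = trans (cong Θ loc) (trans Θs (sym loc))
        ; unioccurrent = λ {k} i≤k k< eq → s⋢ (subst (_⊑ i ⟦ n ⟧) (trans eq loc)
            (slice-⊑ i≤k (≤-pred (≤-trans (+-monoˡ-< (length s) k<)
              (≤-reflexive (trans (+-assoc i _ _) (trans (cong (i +_) end≡) (+-suc i n))))))))
        }
        where
        located = slice-locate i (suc n) p (trans (slice-∷ʳ i n) e)
        loc = proj₁ located
        end≡ : length p + length s ≡ suc n
        end≡ = trans (sym (+-identityʳ _)) (trans
          (cong (λ z → length p + length s + length z)
                (sym (new-suffix (i ⟦ n ⟧) {p = p} {q} e s⋢)))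
          (proj₂ located))

      ups : ∀ i n → w₀ ⊑ i ⟦ n ⟧ → Any (Pair (u (i + n))) (i ⟦ n ⟧) → Ups i (i + suc n)
      ups i n w₀⊑ a∈ = newPal-ups i n (newPal-exists (i ⟦ n ⟧) (u (i + n))
        (ℤ.≤-trans (maximal _ (subst (IsFactor A u) (slice-∷ʳ i n) (isFactor i (suc n))))
                   (defect-⊑ w₀⊑)) a∈)

      -- The proviso on the appended letter holds because that letter is the last one of the word at
      -- `j`: the word at `i` contains it, or contains its image under `Θ`. The length is `suc m` so
      -- that a last letter exists.
      return-ups : ∀ {i j} m → i < j → w₀ ⊑ i ⟦ suc m ⟧ →
        j ⟦ suc m ⟧ ≡ i ⟦ suc m ⟧ ⊎ j ⟦ suc m ⟧ ≡ Θ (i ⟦ suc m ⟧) →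
        Ups i (j + suc m)
      return-ups {i} {j} m i<j w₀⊑ rel with ≤⇒+ i<j
      ... | d , refl = subst (Ups i) (shift-end i d m) (ups i n (⊑-trans w₀⊑ ⊑n) pair)
        where
        n = suc d + m
        ⊑n : i ⟦ suc m ⟧ ⊑ i ⟦ n ⟧
        ⊑n = slice-⊑ ≤-refl (+-monoʳ-≤ i (s≤s (m≤n+m m d)))
        last≡ : u (i + n) ≡ u (suc i + d + m)
        last≡ = cong u (shift-last i d m)
        last∈ : [ u (i + n) ] ⊑ (suc i + d) ⟦ suc m ⟧
        last∈ = (suc i + d) ⟦ m ⟧ , [] , trans (slice-∷ʳ (suc i + d) m)
          (cong (λ a → (suc i + d) ⟦ m ⟧ ++ [ a ]) (sym last≡))
        pair : Any (Pair (u (i + n))) (i ⟦ n ⟧)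
        pair = case rel of λ where
          (inj₁ e) → Any.map (λ { refl → inj₁ refl })
            (⊑⇒∈ (⊑-trans (subst ([ u (i + n) ] ⊑_) e last∈) ⊑n))
          (inj₂ e) → let b , Θa = Θ-letter (u (i + n)) in
            Any.map (λ { refl → inj₂ (trans (sym (involutive [ u (i + n) ])) (cong Θ Θa)) })
              (⊑⇒∈ (⊑-trans (subst₂ _⊑_ Θa (involutive (i ⟦ suc m ⟧))
                (Θ-⊑ (subst ([ u (i + n) ] ⊑_) e last∈))) ⊑n))

      -- A palindromic suffix starting at j or later would occur inside the word of
      -- length m + 1 at i too, hence not be unioccurrent.
      ups-start : ∀ {i j} m → i < j →
        j ⟦ suc m ⟧ ≡ i ⟦ suc m ⟧ ⊎ j ⟦ suc m ⟧ ≡ Θ (i ⟦ suc m ⟧) →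
        (U : Ups i (j + suc m)) → Ups.start U < j × Ups.start U ⟦ suc m ⟧ ≡ Θ (j ⟦ suc m ⟧)
      ups-start {i} {j} m i<j rel U = start<j , start-occ
        where
        open Ups U
        start<j : start < j
        start<j = ≰⇒> λ j≤ → too-late (≤⇒+ j≤)
          where
          too-late : ∃ (λ c → start ≡ j + c) → _
          too-late (c , s≡) = case rel of λ where
              (inj₁ e) → unioccurrent (m≤m+n i c)
                (≤-trans (+-monoˡ-< c i<j) (≤-reflexive (sym s≡)))
                (trans (sym (slice-sub {j} {i} e c (≤-reflexive c+len)))
                       (cong (_⟦ len ⟧) (sym s≡)))
              (inj₂ e) → unioccurrent ≤-refl (≤-trans i<j (≤-trans (m≤m+n j c) (≤-reflexive (sym s≡))))
                (begin
                  i ⟦ len ⟧              ≡⟨ cong (_⟦ len ⟧) (+-identityʳ i) ⟨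
                  (i + 0) ⟦ len ⟧        ≡⟨ involutive ((i + 0) ⟦ len ⟧) ⟨
                  Θ (Θ ((i + 0) ⟦ len ⟧)) ≡⟨ cong Θ (slice-mirror e 0 len c (trans (+-comm len c) c+len)) ⟨
                  Θ ((j + c) ⟦ len ⟧)    ≡⟨ cong (λ z → Θ (z ⟦ len ⟧)) s≡ ⟨
                  Θ (start ⟦ len ⟧)      ≡⟨ palindrome ⟩
                  start ⟦ len ⟧          ∎)
            where
            open ≡-Reasoning
            c+len : c + len ≡ suc m
            c+len = +-cancelˡ-≡ j _ _ (trans (sym (+-assoc j c len)) (trans (cong (_+ len) (sym s≡)) end))
        start-occ : start ⟦ suc m ⟧ ≡ Θ (j ⟦ suc m ⟧)
        start-occ with ≤⇒+ (<⇒≤ start<j)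
        ... | a , j≡ = begin
          start ⟦ suc m ⟧         ≡⟨ cong (_⟦ suc m ⟧) (+-identityʳ start) ⟨
          (start + 0) ⟦ suc m ⟧   ≡⟨ slice-mirror (sym palindrome) a (suc m) 0
                                      (trans (+-identityʳ _) (sym len≡)) ⟩
          Θ ((start + a) ⟦ suc m ⟧) ≡⟨ cong (λ z → Θ (z ⟦ suc m ⟧)) j≡ ⟨
          Θ (j ⟦ suc m ⟧) ∎
          where
          open ≡-Reasoning
          len≡ : len ≡ a + suc m
          len≡ = +-cancelˡ-≡ start _ _ (trans end (trans (cong (_+ suc m) j≡) (+-assoc start a (suc m))))

      ups-return : ∀ {i j} m → i < j → w₀ ⊑ i ⟦ suc m ⟧ →
        j ⟦ suc m ⟧ ≡ i ⟦ suc m ⟧ ⊎ j ⟦ suc m ⟧ ≡ Θ (i ⟦ suc m ⟧) →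
        Σ[ U ∈ Ups i (j + suc m) ] Ups.start U < j × Ups.start U ⟦ suc m ⟧ ≡ Θ (j ⟦ suc m ⟧)
      ups-return m i<j w₀⊑ rel = U , ups-start m i<j rel U
        where U = return-ups m i<j w₀⊑ rel

  -- A prefix w₁ of u that contains w₀ returns, and the palindromic suffix of
  -- w₁ … w₁ shows that Θ(w₁) occurs in u; take a prefix containing both.
  seed : (Θ : Word A → Word A) (Θ-anti : IsInvolutiveAntimorphism A Θ) →
         Recurrent A u → ∀ w₀ → IsFactor A u w₀ →
         (∀ x → IsFactor A u x → defect A Θ x ℤ.≤ defect A Θ w₀) →
         ∃[ m ] w₀ ⊑ 0 ⟦ suc m ⟧ × w₀ ⊑ Θ (0 ⟦ suc m ⟧)
  seed Θ Θ-anti rec w₀ (i , occ) maximal =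
    let j , 0<j , occ-j = rec (0 ⟦ suc m₁ ⟧) (isFactor 0 (suc m₁)) 1
        j≡0 = trans (cong (j ⟦_⟧) (sym (slice-length 0 (suc m₁)))) occ-j
        U , _ , k-occ = ups-return m₁ 0<j w₀⊑ (inj₁ j≡0)
    in extend (Ups.start U) (trans k-occ (cong Θ j≡0))
    where
    open Palindromes A Θ Θ-anti
    open IsInvolutiveAntimorphism Θ-anti
    open Mirror Θ Θ-anti
    open Maximal w₀ maximal
    m₁ = i + length w₀
    w₀⊑ : w₀ ⊑ 0 ⟦ suc m₁ ⟧
    w₀⊑ = subst (_⊑ 0 ⟦ suc m₁ ⟧) occ (slice-⊑ z≤n (n≤1+n m₁))
    extend : ∀ k → k ⟦ suc m₁ ⟧ ≡ Θ (0 ⟦ suc m₁ ⟧) →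
             ∃[ m ] w₀ ⊑ 0 ⟦ suc m ⟧ × w₀ ⊑ Θ (0 ⟦ suc m ⟧)
    -- The prefix of length `suc (k + m₁)` stops exactly where the occurrence of `Θ w₁` at `k` ends;
    -- the image under `Θ` of that prefix therefore contains `w₁`, and with it `w₀`.
    extend k k-occ = k + m₁ , ⊑-trans w₀⊑ (slice-⊑ z≤n (s≤s (m≤n+m m₁ k))) ,
        subst (_⊑ Θ (0 ⟦ suc (k + m₁) ⟧)) (involutive w₀) (Θ-⊑ (⊑-trans (Θ-⊑ w₀⊑)
          (subst (_⊑ 0 ⟦ suc (k + m₁) ⟧) k-occ (slice-⊑ z≤n (≤-reflexive (+-suc k m₁))))))

-- Return words and uniform recurrence

module _ {P : ℕ → Set} (P? : ∀ n → Dec (P n)) where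

  -- A least-witness search in which the known witness at distance `d` bounds the number of steps.
  next : ∀ k d → P (k + d) → ∃[ j ] k ≤ j × P j × (∀ {t} → k ≤ t → t < j → ¬ P t)
  next k d Pkd with P? k
  ... | yes Pk = k , ≤-refl , Pk , λ k≤t t<k → contradiction (≤-trans t<k k≤t) (n≮n _)
  next k zero    Pkd | no ¬Pk = contradiction (subst P (+-identityʳ k) Pkd) ¬Pk
  next k (suc d) Pkd | no ¬Pk with next (suc k) d (subst P (+-suc k d) Pkd)
  ... | j , k<j , Pj , none = j , <⇒≤ k<j , Pj , none′
    where
    none′ : ∀ {t} → k ≤ t → t < j → ¬ P t
    none′ k≤t t<j Pt with m≤n⇒m<n∨m≡n k≤t
    ... | inj₁ k<t  = none k<t t<j Pt
    ... | inj₂ refl = ¬Pk Pt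

  previous : ∀ a d → P a → ∃[ l ] a ≤ l × l ≤ a + d × P l × (∀ {t} → l < t → t ≤ a + d → ¬ P t)
  previous a zero    Pa = a , ≤-refl , m≤m+n a 0 , Pa ,
    λ a<t t≤ → contradiction (≤-trans a<t (≤-trans t≤ (≤-reflexive (+-identityʳ a)))) (n≮n _)
  previous a (suc d) Pa with P? (a + suc d)
  ... | yes P′ = a + suc d , m≤m+n a _ , ≤-refl , P′ , λ l<t t≤ → contradiction (≤-trans l<t t≤) (n≮n _)
  ... | no ¬P′ with previous a d Pa
  ... | l , a≤l , l≤ , Pl , none = l , a≤l , ≤-trans l≤ (+-monoʳ-≤ a (n≤1+n d)) , Pl , none′
    where
    none′ : ∀ {t} → l < t → t ≤ a + suc d → ¬ P t
    none′ l<t t≤ Pt with m≤n⇒m<n∨m≡n t≤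
    ... | inj₁ t<   = none l<t (≤-pred (≤-trans t< (≤-reflexive (+-suc a d)))) Pt
    ... | inj₂ refl = ¬P′ Pt

uniform-bound : {X : Set} (P : X → ℕ → Set) → (∀ {x m n} → m ≤ n → P x m → P x n) →
                ∀ xs → (∀ {x} → x ∈ xs → ∃ (P x)) → ∃[ N ] (∀ {x} → x ∈ xs → P x N)
uniform-bound P mono []       h = 0 , λ ()
uniform-bound P mono (x ∷ xs) h with h (here refl) | uniform-bound P mono xs (h ∘ there)
... | m , Px | n , Pxs = m ⊔ n , λ where
  (here refl) → mono (m≤m⊔n m n) Px
  (there x∈)  → mono (m≤n⊔m m n) (Pxs x∈)

finite-⊆ : {X : Set} {P : X → Set} → (∀ x → Dec (P x)) → ∀ xs → (∀ {x} → P x → x ∈ xs) → Finite P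
finite-⊆ P? xs h = filter P? xs , λ x →
  mk⇔ (λ Px → ∈-filter⁺ P? (h Px) Px) (proj₂ ∘ ∈-filter⁻ P? {xs = xs})

-- Uniform recurrence without reference to return words.
Windowed : (A : FiniteAlphabet) → InfiniteWord A → Set
Windowed A u = ∀ n → ∃[ M ] (∀ i k → ∃[ j ] k ≤ j × j < k + M × slice A u j n ≡ slice A u i n)

module Occurrences (A : FiniteAlphabet) where

  open FiniteAlphabet A using (_≟_; _≟ʷ_)

  prefix-++ : (z r : Word A) → Prefix _≡_ z (z ++ r)
  prefix-++ []      r = []
  prefix-++ (a ∷ z) r = refl ∷ prefix-++ z r

  prefix-++⁻ : {z y : Word A} → Prefix _≡_ z y → ∃[ r ] y ≡ z ++ r
  prefix-++⁻ {y = y} []         = y , refl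
  prefix-++⁻         (refl ∷ p) with prefix-++⁻ p
  ... | r , refl = r , refl

  occ : Word A → Word A → ℕ
  occ = occurrences A

  occ-accept : ∀ z a y → Prefix _≡_ z (a ∷ y) → occ z (a ∷ y) ≡ suc (occ z y)
  occ-accept z a y p = cong length (filter-accept (prefix? _≟_ z) p)

  occ-reject : ∀ z a y → ¬ Prefix _≡_ z (a ∷ y) → occ z (a ∷ y) ≡ occ z y
  occ-reject z a y ¬p = cong length (filter-reject (prefix? _≟_ z) ¬p)

  occ-∷ : ∀ z a y → occ z y ≤ occ z (a ∷ y)
  occ-∷ z a y with prefix? _≟_ z (a ∷ y)
  ... | yes _ = n≤1+n _
  ... | no  _ = ≤-refl

  occ-++ : ∀ z p y → occ z y ≤ occ z (p ++ y)
  occ-++ z []      y = ≤-refl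
  occ-++ z (a ∷ p) y = ≤-trans (occ-++ z p y) (occ-∷ z a (p ++ y))

  occ-prefix : ∀ z r → 1 ≤ occ z (z ++ r)
  occ-prefix []      r = s≤s z≤n
  occ-prefix (a ∷ z) r = ≤-trans (s≤s z≤n) 
    (≤-reflexive (sym (occ-accept (a ∷ z) a (z ++ r) (prefix-++ (a ∷ z) r))))

  occ-short : ∀ z y → length y < length z → occ z y ≡ 0
  occ-short (_ ∷ _) []      _  = refl
  occ-short z       (b ∷ y) l< = trans
    (occ-reject z b y λ p → let r , e = prefix-++⁻ p in
      <⇒≱ l< (≤-trans (length-++-≤ˡ z) (≤-reflexive (cong length (sym e)))))
    (occ-short z y (<⇒≤ l<))

  occ-self : ∀ z → occ z z ≡ 1
  occ-self []      = refl
  occ-self (a ∷ z) = trans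
    (occ-accept (a ∷ z) a z (subst (Prefix _≡_ (a ∷ z)) (++-identityʳ (a ∷ z)) (prefix-++ (a ∷ z) [])))
    (cong suc (occ-short (a ∷ z) z ≤-refl))

  module _ (u : InfiniteWord A) where

    open Slices A u

    slice-prefix⁺ : ∀ l a n {z} → l ⟦ n ⟧ ≡ z → ∃[ r ] l ⟦ a + n ⟧ ≡ z ++ r
    slice-prefix⁺ l a n refl = (l + n) ⟦ a ⟧ , trans (cong (l ⟦_⟧) (+-comm a n)) (slice-+ l n a)

    slice-prefix⁻ : ∀ l a {z} → Prefix _≡_ z (l ⟦ a + length z ⟧) → l ⟦ length z ⟧ ≡ z
    slice-prefix⁻ l a {z} p with prefix-++⁻ p
    ... | r , e = proj₁ (++-split (l ⟦ length z ⟧) z (slice-length l (length z))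
      (trans (sym (slice-+ l (length z) a)) (trans (cong (l ⟦_⟧) (+-comm (length z) a)) e)))

    occ-slice-once : ∀ z l a → (l + a) ⟦ length z ⟧ ≡ z →
      (∀ {t} → l ≤ t → t < l + a → t ⟦ length z ⟧ ≢ z) → occ z (l ⟦ a + length z ⟧) ≡ 1
    occ-slice-once z l zero    e none = trans
      (cong (occ z) (trans (cong (_⟦ length z ⟧) (sym (+-identityʳ l))) e)) (occ-self z)
    occ-slice-once z l (suc a) e none = begin
      occ z (l ⟦ suc (a + length z) ⟧)        ≡⟨ cong (occ z) (slice-suc l (a + length z)) ⟩
      occ z (u l ∷ suc l ⟦ a + length z ⟧)    ≡⟨ occ-reject z (u l) (suc l ⟦ a + length z ⟧)
        (λ p → none ≤-refl (m<m+n l (s≤s z≤n))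
        (slice-prefix⁻ l (suc a) (subst (Prefix _≡_ z) (sym (slice-suc l (a + length z))) p))) ⟩
      occ z (suc l ⟦ a + length z ⟧)          ≡⟨ occ-slice-once z (suc l) a
        (trans (cong (_⟦ length z ⟧) (sym (+-suc l a))) e)
        (λ l< t< → none (<⇒≤ l<) (≤-trans t< (≤-reflexive (sym (+-suc l a))))) ⟩
      1                                       ∎
      where open ≡-Reasoning

    occ-slice-accept : ∀ z l a → l ⟦ length z ⟧ ≡ z →
      occ z (l ⟦ suc a + length z ⟧) ≡ suc (occ z (suc l ⟦ a + length z ⟧))
    occ-slice-accept z l a e with slice-prefix⁺ l (suc a) (length z) e
    ... | r , f = trans (cong (occ z) (slice-suc l (a + length z)))
      (occ-accept z (u l) (suc l ⟦ a + length z ⟧)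
        (subst (Prefix _≡_ z) (trans (sym f) (slice-suc l (a + length z))) (prefix-++ z r)))

    occ-slice-skip : ∀ z l b a → occ z ((l + b) ⟦ a + length z ⟧) ≤ occ z (l ⟦ b + a + length z ⟧)
    occ-slice-skip z l b a = ≤-trans (occ-++ z (l ⟦ b ⟧) ((l + b) ⟦ a + length z ⟧))
      (≤-reflexive (cong (occ z) (trans (sym (slice-+ l b (a + length z)))
        (cong (l ⟦_⟧) (sym (+-assoc b a (length z)))))))

    -- The count of two splits into the occurrence at `l` and the single one left once the first
    -- letter is dropped.
    returnWord : ∀ {z} l d → l ⟦ length z ⟧ ≡ z → (l + suc d) ⟦ length z ⟧ ≡ z →
      (∀ {t} → l < t → t < l + suc d → t ⟦ length z ⟧ ≢ z) → IsReturnWord A u z (l ⟦ suc d ⟧)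
    returnWord {z} l d start end none =
      subst (IsFactor A u) eq (isFactor l (suc d + n)) ,
      (let r , e = slice-prefix⁺ l (suc d) n start in
        subst (Prefix _≡_ z) (trans (sym e) eq) (prefix-++ z r)) ,
      (l ⟦ suc d ⟧ ++ˢ Suffix.here (Pointwise.refl refl)) ,
      trans (cong (occ z) (sym eq)) (trans (occ-slice-accept z l d start)
        (cong suc (occ-slice-once z (suc l) d (trans (cong (_⟦ n ⟧) (sym (+-suc l d))) end)
          λ l<t t< → none l<t (≤-trans t< (≤-reflexive (sym (+-suc l d)))))))
      where
      n = length z
      eq : l ⟦ suc d + n ⟧ ≡ l ⟦ suc d ⟧ ++ z
      eq = trans (slice-+ l (suc d) n) (cong (l ⟦ suc d ⟧ ++_) end)

    module FromReturnWords (ur : UniformlyRecurrent A u) where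

      module _ (z : Word A) (a : ℕ) (occurs : OccursAt A u z a) where

        occurs? : ∀ i → Dec (OccursAt A u z i)
        occurs? i = i ⟦ length z ⟧ ≟ʷ z

        returns : List (Word A)
        returns = proj₁ (proj₂ ur z (a , occurs))

        -- Positions are written `a + d` because only from the known occurrence at `a` onwards is
        -- there an occurrence to the left.
        enclosing : ∀ d → ∃₂ λ l e → l ≤ a + d × a + d < l + suc e ×
                    OccursAt A u z (l + suc e) × l ⟦ suc e ⟧ ∈ returns
        enclosing d with previous occurs? a d occurs | proj₁ ur z (a , occurs) (suc (a + d))
        ... | l , _ , l≤ , occ-l , none-l | i , a+d<i , occ-i with ≤⇒+ a+d<i
        ... | c , refl with next occurs? (suc (a + d)) c occ-i
        ... | j , a+d<j , occ-j , none-j with ≤⇒+ (≤-trans (s≤s l≤) a+d<j)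
        ... | e , refl = l , e , l≤ , ≤-trans a+d<j (≤-reflexive (sym (+-suc l e))) ,
          subst (OccursAt A u z) (sym (+-suc l e)) occ-j ,
          Equivalence.to (proj₂ (proj₂ ur z (a , occurs)) (l ⟦ suc e ⟧))
            (returnWord l e occ-l (subst (OccursAt A u z) (sym (+-suc l e)) occ-j) none)
          where
          none : ∀ {t} → l < t → t < l + suc e → t ⟦ length z ⟧ ≢ z
          none {t} l<t t< with t ≤? a + d
          ... | yes t≤ = none-l l<t t≤
          ... | no  t≰ = none-j (≰⇒> t≰) (≤-trans t< (≤-reflexive (+-suc l e)))

        gap : ∃[ N ] (∀ k → ∃[ j ] k ≤ j × j < k + N × OccursAt A u z j)
        -- `N₀` bounds the return words and serves every `k` after `a`; the summand `suc a` serves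
        -- the earlier `k`, for which the occurrence at `a` itself is taken.
        gap = N₀ + suc a , window
          where
          bound = uniform-bound (λ q n → length q ≤ n) (flip ≤-trans) returns (λ _ → _ , ≤-refl)
          N₀ = proj₁ bound
          window : ∀ k → ∃[ j ] k ≤ j × j < k + (N₀ + suc a) × OccursAt A u z j
          window k with k ≤? a
          ... | yes k≤a = a , k≤a ,
            ≤-trans (m≤n+m (suc a) (k + N₀)) (≤-reflexive (+-assoc k N₀ (suc a))) , occurs
          ... | no  k≰a with ≤⇒+ (≰⇒> k≰a)
          ... | d , refl with enclosing d
          ... | l , e , l≤ , d< , occ-j , q∈ = l + suc e , d< , s≤s (begin
            l + suc e                 ≡⟨ cong (l +_) (slice-length l (suc e)) ⟨
            l + length (l ⟦ suc e ⟧)  ≤⟨ +-mono-≤ l≤ (proj₂ bound q∈) ⟩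
            a + d + N₀                ≤⟨ +-monoʳ-≤ (a + d) (m≤m+n N₀ (suc a)) ⟩
            a + d + (N₀ + suc a)      ∎) , occ-j
            where open ≤-Reasoning

      EarlyBy : ℕ → Word A → ℕ → Set
      EarlyBy n q M = ∀ i → i ⟦ n ⟧ ⊑ q ++ 0 ⟦ n ⟧ → ∃[ j ] j < M × j ⟦ n ⟧ ≡ i ⟦ n ⟧

      -- The prefix `z` of length `n` occurs at 0, so every position lies between consecutive
      -- occurrences of `z`, and the factor of length `n` there lies in `q ++ z` for a return word
      -- `q`. There are finitely many such `q`, and each `q ++ z` occurs somewhere.
      initial : ∀ n → ∃[ M ] (∀ i → ∃[ j ] j < M × j ⟦ n ⟧ ≡ i ⟦ n ⟧)
      initial n = M , λ i → let l , e , l≤ , i< , occ-j , q∈ = enclosing z 0 (occursAt 0 n) i in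
        early q∈ i (subst (i ⟦ n ⟧ ⊑_)
          (trans (slice-+ l (suc e) n) (cong (l ⟦ suc e ⟧ ++_)
            (trans (cong ((l + suc e) ⟦_⟧) (sym (slice-length 0 n))) occ-j)))
          (slice-⊑ l≤ (≤-trans (+-monoˡ-≤ n (<⇒≤ i<)) (≤-reflexive (+-assoc l (suc e) n)))))
        where
        z = 0 ⟦ n ⟧
        qs = returns z 0 (occursAt 0 n)
        early-factor : ∀ {q} → q ∈ qs → ∃ (EarlyBy n q)
        early-factor {q} q∈ with Equivalence.from (proj₂ (proj₂ ur z (0 , occursAt 0 n)) q) q∈
        ... | (f , occ-f) , _ = suc (f + length (q ++ z)) , λ i i⊑ →
          let b , b≤ , e = ⊑-slice (subst (i ⟦ n ⟧ ⊑_) (sym occ-f) i⊑) in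
          f + b , s≤s (+-monoʳ-≤ f (≤-trans (m≤m+n b _) b≤)) ,
          trans (cong ((f + b) ⟦_⟧) (sym (slice-length i n))) e
        bound = uniform-bound (EarlyBy n)
          (λ m≤n h i i⊑ → let j , j< , e = h i i⊑ in j , ≤-trans j< m≤n , e) qs early-factor
        M = proj₁ bound
        early : ∀ {q} → q ∈ qs → EarlyBy n q M
        early = proj₂ bound

      Everywhere : ℕ → ℕ → ℕ → Set
      Everywhere n t N = ∀ k → ∃[ j ] k ≤ j × j < k + N × j ⟦ n ⟧ ≡ t ⟦ n ⟧

      everywhere-widen : ∀ {n t N N′} → N ≤ N′ → Everywhere n t N → Everywhere n t N′
      everywhere-widen N≤ h k =
        let j , k≤j , j< , e = h k in j , k≤j , ≤-trans j< (+-monoʳ-≤ k N≤) , e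

      everywhere : ∀ n t → ∃ (Everywhere n t)
      everywhere n t = subst (λ l → ∃[ N ] (∀ k → ∃[ j ] k ≤ j × j < k + N × j ⟦ l ⟧ ≡ t ⟦ n ⟧))
        (slice-length t n) (gap (t ⟦ n ⟧) t (occursAt t n))

      -- By `initial` only the factors starting before `M` matter, so finitely many gap bounds have
      -- a common upper bound.
      windowed : Windowed A u
      windowed n with initial n
      ... | M , early with uniform-bound (Everywhere n) (everywhere-widen {n}) (upTo M) (λ {t} _ → everywhere n t)
      ... | N , all = N , λ i k → let t , t<M , t≡ = early i
                                      j , k≤j , j< , e = all (∈-upTo⁺ t<M) k
                                  in j , k≤j , j< , trans e t≡

    module FromWindows (windows : Windowed A u) where

      recurrent : Recurrent A u
      recurrent w (i , occ-i) n with windows (length w)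
      ... | M , h with h i n
      ... | j , n≤j , _ , e = j , n≤j , trans e occ-i

      isFactor? : ∀ w → Dec (IsFactor A u w)
      isFactor? w with windows (length w)
      ... | M , h = map′ (λ (j , _ , e) → j , e)
        (λ (i , occ-i) → let j , _ , j< , e = h i 0 in j , j< , trans e occ-i)
        (anyUpTo? (λ j → j ⟦ length w ⟧ ≟ʷ w) M)

      isReturnWord? : ∀ w q → Dec (IsReturnWord A u w q)
      isReturnWord? w q = isFactor? (q ++ w) ×-dec prefix? _≟_ w (q ++ w) ×-dec
        suffix? _≟_ w (q ++ w) ×-dec (occ w (q ++ w) ℕ.≟ 2)

      -- Contradicts the count of two in a return word that would be too long. Each of the first two
      -- occurrences is counted by `occ-slice-accept`, and the letters in between are skipped, which
      -- can only lose occurrences.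
      three-occurrences : ∀ {z} l b c → OccursAt A u z l → OccursAt A u z (l + suc b) →
        OccursAt A u z (l + suc b + suc c) → 3 ≤ occ z (l ⟦ suc b + suc c + length z ⟧)
      three-occurrences {z} l b c e₀ e₁ e₂ = begin
        3
          ≤⟨ s≤s (s≤s (subst (λ x → 1 ≤ occ z x) (trans (++-identityʳ z) (sym e₂)) (occ-prefix z []))) ⟩
        2 + occ z ((l + suc b + suc c) ⟦ n ⟧)
          ≡⟨ cong (λ i → 2 + occ z (i ⟦ n ⟧)) (+-suc (l + suc b) c) ⟩
        2 + occ z ((suc (l + suc b) + c) ⟦ n ⟧)
          ≤⟨ s≤s (s≤s (occ-slice-skip z (suc (l + suc b)) c 0)) ⟩
        2 + occ z (suc (l + suc b) ⟦ c + 0 + n ⟧)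
          ≡⟨ cong (λ i → 2 + occ z (suc (l + suc b) ⟦ i + n ⟧)) (+-identityʳ c) ⟩
        2 + occ z (suc (l + suc b) ⟦ c + n ⟧)
          ≡⟨ cong suc (occ-slice-accept z (l + suc b) c e₁) ⟨
        1 + occ z ((l + suc b) ⟦ suc c + n ⟧)
          ≡⟨ cong (λ i → suc (occ z (i ⟦ suc c + n ⟧))) (+-suc l b) ⟩
        1 + occ z ((suc l + b) ⟦ suc c + n ⟧)
          ≤⟨ s≤s (occ-slice-skip z (suc l) b (suc c)) ⟩
        1 + occ z (suc l ⟦ b + suc c + n ⟧)
          ≡⟨ occ-slice-accept z l (b + suc c) e₀ ⟨
        occ z (l ⟦ suc b + suc c + n ⟧)
          ∎
        where
        open ≤-Reasoning
        n = length z

      -- A return word longer than the window `M` of `z` would have a third occurrence of `z`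
      -- strictly inside. So every return word starts a factor of length `M + length z`, and such a
      -- factor also occurs before `M₂`: the candidates form a finite list, and being a return word
      -- is decidable.
      finite-returns : ∀ z → IsFactor A u z → Finite (IsReturnWord A u z)
      finite-returns z (a , occ-a) with windows (length z)
      ... | M , h with windows (M + length z)
      ... | M₂ , h₂ = finite-⊆ (isReturnWord? z)
          (cartesianProductWith _⟦_⟧ (upTo M₂) (upTo (suc M))) candidate
        where
        n = length z
        candidate : ∀ {q} → IsReturnWord A u z q →
                    q ∈ cartesianProductWith _⟦_⟧ (upTo M₂) (upTo (suc M))
        candidate {q} ((l , occ-l) , pre , _ , occ≡2) =
          let j , _ , j<M₂ , j≡ = h₂ l 0 in
          subst (_∈ cartesianProductWith _⟦_⟧ (upTo M₂) (upTo (suc M)))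
            (trans (slice-take j≡ (≤-trans short (m≤m+n M n))) q≡)
            (∈-cartesianProductWith⁺ _⟦_⟧ (∈-upTo⁺ j<M₂) (∈-upTo⁺ (s≤s short)))
          where
          d = length q
          occ-l′ : l ⟦ d + n ⟧ ≡ q ++ z
          occ-l′ = trans (cong (l ⟦_⟧) (sym (length-++ q))) occ-l
          both : l ⟦ d ⟧ ≡ q × (l + d) ⟦ n ⟧ ≡ z
          both = ++-split (l ⟦ d ⟧) q (slice-length l d) (trans (sym (slice-+ l d n)) occ-l′)
          q≡ = proj₁ both
          short : d ≤ M
          short = ≮⇒≥ λ M<d → tooMany M<d (h a (suc l))
            where
            tooMany : M < d → ¬ (∃[ j ] suc l ≤ j × j < suc l + M × j ⟦ n ⟧ ≡ a ⟦ n ⟧)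
            tooMany M<d (j , l<j , j< , j≡) with ≤⇒+ l<j
            ... | b , refl with ≤⇒+ (≤-trans (s≤s (+-cancelˡ-< (suc l) b M j<)) M<d)
            ... | c , d≡ = <⇒≢ (three-occurrences l b c
                  (slice-prefix⁻ l d (subst (Prefix _≡_ z) (sym occ-l′) pre))
                  (trans (cong (_⟦ n ⟧) (+-suc l b)) (trans j≡ occ-a))
                  (trans (cong (_⟦ n ⟧) (trans (+-assoc l (suc b) (suc c)) (cong (l +_) (sym d≡′))))
                         (proj₂ both)))
                (sym (trans (cong (occ z) (trans (cong (λ i → l ⟦ i + n ⟧) (sym d≡′)) occ-l′)) occ≡2))
              where
              d≡′ : d ≡ suc b + suc c
              d≡′ = trans d≡ (sym (+-suc (suc b) c))

      uniformlyRecurrent : UniformlyRecurrent A u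
      uniformlyRecurrent = recurrent , finite-returns

-- Block decomposition

regroup : ∀ c t m r → suc c + m + (suc t + r) ≡ suc (suc t) + c + m + r
regroup = solve-∀

-- `gap` is what makes the enumeration exhaustive: with `pos-0` it yields `pos-onto`.
record Marks (X : ℕ → Set) (M : ℕ) : Set where
  field
    pos len : ℕ → ℕ
    pos-0   : pos 0 ≡ 0
    pos-suc : ∀ n → pos (suc n) ≡ pos n + len n
    pos-X   : ∀ n → X (pos n)
    len>0   : ∀ n → 0 < len n
    len≤    : ∀ n → len n ≤ M
    gap     : ∀ n {t} → 0 < t → t < len n → ¬ X (pos n + t)

  pos-+ : ∀ n t → pos n + t ≤ pos (n + t)
  pos-+ n zero    = ≤-reflexive (trans (+-identityʳ _) (cong pos (sym (+-identityʳ n))))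
  pos-+ n (suc t) = begin
    pos n + suc t             ≡⟨ +-suc (pos n) t ⟩
    suc (pos n + t)           ≤⟨ s≤s (pos-+ n t) ⟩
    suc (pos (n + t))         ≡⟨ +-comm 1 _ ⟩
    pos (n + t) + 1           ≤⟨ +-monoʳ-≤ _ (len>0 (n + t)) ⟩
    pos (n + t) + len (n + t) ≡⟨ pos-suc (n + t) ⟨
    pos (suc (n + t))         ≡⟨ cong pos (+-suc n t) ⟨
    pos (n + suc t)           ∎
    where open ≤-Reasoning

  pos-+-≤ : ∀ n t → pos (n + t) ≤ pos n + t * M
  pos-+-≤ n zero    = ≤-reflexive (trans (cong pos (+-identityʳ n)) (sym (+-identityʳ _)))
  pos-+-≤ n (suc t) = begin
    pos (n + suc t)           ≡⟨ cong pos (+-suc n t) ⟩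
    pos (suc (n + t))         ≡⟨ pos-suc (n + t) ⟩
    pos (n + t) + len (n + t) ≤⟨ +-mono-≤ (pos-+-≤ n t) (len≤ (n + t)) ⟩
    pos n + t * M + M         ≡⟨ +-assoc (pos n) (t * M) M ⟩
    pos n + (t * M + M)       ≡⟨ cong (pos n +_) (+-comm (t * M) M) ⟩
    pos n + suc t * M         ∎
    where open ≤-Reasoning

  n≤pos : ∀ n → n ≤ pos n
  n≤pos n = ≤-trans (≤-reflexive (cong (_+ n) (sym pos-0))) (pos-+ 0 n)

  pos-mono-≤ : ∀ {n k} → n ≤ k → pos n ≤ pos k
  pos-mono-≤ {n} n≤k with ≤⇒+ n≤k
  ... | t , refl = ≤-trans (m≤m+n (pos n) t) (pos-+ n t)

  pos-mono-< : ∀ {n k} → n < k → pos n < pos k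
  pos-mono-< {n} n<k = ≤-trans (≤-trans (m<m+n (pos n) (len>0 n)) (≤-reflexive (sym (pos-suc n))))
                               (pos-mono-≤ n<k)

  pos-cancel-≤ : ∀ {n k} → pos n ≤ pos k → n ≤ k
  pos-cancel-≤ p = ≮⇒≥ λ k<n → <⇒≱ (pos-mono-< k<n) p

  pos-cancel-< : ∀ {n k} → pos n < pos k → n < k
  pos-cancel-< p = ≰⇒> λ k≤n → <⇒≱ p (pos-mono-≤ k≤n)

  gap-start : ∀ n {p} → X p → pos n ≤ p → p < pos (suc n) → p ≡ pos n
  gap-start n Xp n≤p p< with ≤⇒+ n≤p
  ... | zero  , refl = +-identityʳ (pos n)
  ... | suc t , refl = contradiction Xp
    (gap n (s≤s z≤n) (+-cancelˡ-< (pos n) (suc t) (len n) (≤-trans p< (≤-reflexive (pos-suc n)))))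

  pos-onto : ∀ {p} → X p → ∃[ n ] p ≡ pos n
  -- Positions grow by at least one per index, so `p` lies before `pos (suc p)` and `suc p` steps
  -- suffice.
  pos-onto {p} Xp = go (suc p) 0 (≤-trans (≤-reflexive pos-0) z≤n) (n≤pos (suc p))
    where
    go : ∀ d n → pos n ≤ p → p < pos (n + d) → ∃[ n ] p ≡ pos n
    go zero    n n≤p p< = contradiction
      (≤-trans p< (≤-trans (≤-reflexive (cong pos (+-identityʳ n))) n≤p)) (n≮n p)
    go (suc d) n n≤p p< with p <? pos (suc n)
    ... | yes p<suc = n , gap-start n Xp n≤p p<suc
    ... | no  p≮suc = go d (suc n) (≮⇒≥ p≮suc) (≤-trans p< (≤-reflexive (cong pos (+-suc n d))))

marks : ∀ {X : ℕ → Set} {M} → (∀ n → Dec (X n)) → X 0 →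
        (∀ p → ∃[ j ] p < j × j ≤ p + M × X j) → Marks X M
marks {X} {M} X? X0 later = record
  { pos = λ n → proj₁ (state n)
  ; len = λ n → proj₁ (step (proj₁ (state n)))
  ; pos-0 = refl
  ; pos-suc = λ _ → refl
  ; pos-X = λ n → proj₂ (state n)
  ; len>0 = λ n → proj₁ (proj₂ (step (proj₁ (state n))))
  ; len≤ = λ n → proj₁ (proj₂ (proj₂ (step (proj₁ (state n)))))
  ; gap = λ n → proj₂ (proj₂ (proj₂ (proj₂ (step (proj₁ (state n))))))
  }
  where
  step : ∀ p → ∃[ d ] 0 < d × d ≤ M × X (p + d) × (∀ {t} → 0 < t → t < d → ¬ X (p + t))
  step p with later p
  ... | j , p<j , j≤ , Xj with ≤⇒+ p<j
  -- The search starts at offset 1 to keep `d` positive. The known element at offset `suc c` bounds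
  -- the least one, hence `d ≤ M`.
  ... | c , refl with next (λ t → X? (p + t)) 1 c (subst X (sym (+-suc p c)) Xj)
  ... | d , 0<d , Xd , none = d , 0<d ,
    ≤-trans (≮⇒≥ λ c<d → none (s≤s z≤n) c<d (subst X (sym (+-suc p c)) Xj))
            (+-cancelˡ-≤ p (suc c) M (≤-trans (≤-reflexive (+-suc p c)) j≤)) ,
    Xd , none
  state : ℕ → ∃ X
  state zero    = 0 , X0
  state (suc n) = let p , _ = state n ; d , _ , _ , Xd , _ = step p in p + d , Xd

-- Marks are the occurrences of w and Θ(w), w being the prefix of u of length m.
-- Consecutive blocks overlap in m letters: this is what makes them palindromes.
module Blocks (A : FiniteAlphabet) (Θ : Word A → Word A)
              (Θ-anti : IsInvolutiveAntimorphism A Θ) (u : InfiniteWord A) (m : ℕ) where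

  open FiniteAlphabet A using (_≟ʷ_)
  open Slices A u
  open IsInvolutiveAntimorphism Θ-anti
  open Mirror Θ Θ-anti

  Mark : ℕ → Set
  Mark i = i ⟦ m ⟧ ≡ 0 ⟦ m ⟧ ⊎ i ⟦ m ⟧ ≡ Θ (0 ⟦ m ⟧)

  mark? : ∀ i → Dec (Mark i)
  mark? i = (i ⟦ m ⟧ ≟ʷ 0 ⟦ m ⟧) ⊎-dec (i ⟦ m ⟧ ≟ʷ Θ (0 ⟦ m ⟧))

  mark-cong : ∀ {i j} → i ⟦ m ⟧ ≡ j ⟦ m ⟧ → Mark i → Mark j
  mark-cong e (inj₁ f) = inj₁ (trans (sym e) f)
  mark-cong e (inj₂ f) = inj₂ (trans (sym e) f)

  mark-Θ : ∀ {i j} → j ⟦ m ⟧ ≡ Θ (i ⟦ m ⟧) → Mark i → Mark j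
  mark-Θ e (inj₁ f) = inj₂ (trans e (cong Θ f))
  mark-Θ e (inj₂ f) = inj₁ (trans e (trans (cong Θ f) (involutive (0 ⟦ m ⟧))))

  mark-relate : ∀ {i j} → Mark i → Mark j → j ⟦ m ⟧ ≡ i ⟦ m ⟧ ⊎ j ⟦ m ⟧ ≡ Θ (i ⟦ m ⟧)
  mark-relate (inj₁ e) (inj₁ f) = inj₁ (trans f (sym e))
  mark-relate (inj₁ e) (inj₂ f) = inj₂ (trans f (cong Θ (sym e)))
  mark-relate (inj₂ e) (inj₂ f) = inj₁ (trans f (sym e))
  mark-relate (inj₂ e) (inj₁ f) = inj₂ (trans f (trans (sym (involutive (0 ⟦ m ⟧))) (cong Θ (sym e))))

  PalindromicBlocks : ∀ {M} → Marks Mark M → Set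
  PalindromicBlocks marked = ∀ n → Θ (pos n ⟦ len n + m ⟧) ≡ pos n ⟦ len n + m ⟧
    where
    open Marks marked

  module Decode {M : ℕ} (marked : Marks Mark M) (block-palindrome : PalindromicBlocks marked) where

    open Marks marked

    block : ℕ → Word A
    block n = pos n ⟦ len n + m ⟧

    block-len : ∀ {n k} → block k ≡ block n → len k ≡ len n
    block-len {n} {k} e = +-cancelʳ-≡ m (len k) (len n)
      (trans (sym (slice-length (pos k) (len k + m)))
        (trans (cong length e) (slice-length (pos n) (len n + m))))

    block-head : ∀ {n k} → block k ≡ block n → pos k ⟦ len n ⟧ ≡ pos n ⟦ len n ⟧
    block-head {n} {k} e = slice-take
      (trans (cong (λ l → pos k ⟦ l + m ⟧) (sym (block-len e))) e) (m≤m+n (len n) m)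

    first-block-fits : ∀ t {n N} → pos (n + suc t) + m ≤ pos n + N → len n + m ≤ N
    first-block-fits t {n} {N} long = +-cancelˡ-≤ (pos n) (len n + m) N (begin
      pos n + (len n + m)   ≡⟨ +-assoc (pos n) (len n) m ⟨
      pos n + len n + m     ≡⟨ cong (_+ m) (pos-suc n) ⟨
      pos (suc n) + m       ≤⟨ +-monoˡ-≤ m (pos-mono-≤ (m<m+n n (s≤s z≤n))) ⟩
      pos (n + suc t) + m   ≤⟨ long ⟩
      pos n + N             ∎)
      where open ≤-Reasoning

    drop-first-block : ∀ t {n r} → pos (n + suc t) + m ≤ pos n + (len n + m + r) →
                       pos (suc n + t) + m ≤ pos (suc n) + (m + r)
    drop-first-block t {n} {r} long = begin
      pos (suc n + t) + m           ≡⟨ cong (λ i → pos i + m) (+-suc n t) ⟨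
      pos (n + suc t) + m           ≤⟨ long ⟩
      pos n + (len n + m + r)       ≡⟨ cong (pos n +_) (+-assoc (len n) m r) ⟩
      pos n + (len n + (m + r))     ≡⟨ +-assoc (pos n) (len n) (m + r) ⟨
      pos n + len n + (m + r)       ≡⟨ cong (_+ (m + r)) (pos-suc n) ⟨
      pos (suc n) + (m + r)         ∎
      where open ≤-Reasoning

    pos-suc-mark : ∀ n → Mark (pos n + len n)
    pos-suc-mark n = subst Mark (pos-suc n) (pos-X (suc n))

    -- Agreement over block `n` includes the whole mark that ends it. Were the lengths different,
    -- the nearer of the two next marks would be copied strictly inside the other gap.
    block-unique : ∀ {n k N} → pos k ⟦ N ⟧ ≡ pos n ⟦ N ⟧ → len n + m ≤ N → block k ≡ block n
    block-unique {n} {k} {N} e n≤N = trans (cong (λ l → pos k ⟦ l + m ⟧) len≡)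
      (slice-take e n≤N)
      where
      len≡ : len k ≡ len n
      len≡ with <-cmp (len k) (len n)
      ... | tri≈ _ eq _ = eq
      ... | tri< k<n _ _ = contradiction
        (mark-cong (slice-sub e (len k) (≤-trans (+-monoˡ-≤ m (<⇒≤ k<n)) n≤N)) (pos-suc-mark k))
        (gap n (len>0 k) k<n)
      ... | tri> _ _ n<k = contradiction
        (mark-cong (sym (slice-sub e (len n) n≤N)) (pos-suc-mark n))
        (gap k (len>0 n) n<k)

    -- Decoding from left to right. Removing `len n` letters keeps the `m` letters of overlap, so
    -- the remaining words again start at corresponding marks.
    blocks-unique : ∀ t {n k N} → pos k ⟦ N ⟧ ≡ pos n ⟦ N ⟧ → pos (n + t) + m ≤ pos n + N →
                    ∀ {s} → s < t → block (k + s) ≡ block (n + s)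
    blocks-unique (suc t) {n} {k} {N} e long {s} s<t with ≤⇒+ (first-block-fits t {n} long)
    ... | r , refl = go s<t
      where
      first : block k ≡ block n
      first = block-unique {n} {k} e (m≤m+n _ r)
      rest : pos (suc k) ⟦ m + r ⟧ ≡ pos (suc n) ⟦ m + r ⟧
      rest = subst₂ (λ i j → i ⟦ m + r ⟧ ≡ j ⟦ m + r ⟧)
        (trans (cong (pos k +_) (sym (block-len first))) (sym (pos-suc k))) (sym (pos-suc n))
        (slice-sub e (len n) (≤-reflexive (sym (+-assoc (len n) m r))))
      go : ∀ {s} → s < suc t → block (k + s) ≡ block (n + s)
      go {zero}  _         = trans (cong block (+-identityʳ k))
        (trans first (cong block (sym (+-identityʳ n))))
      go {suc s} (s≤s s<t) = subst₂ (λ i j → block i ≡ block j) (sym (+-suc k s)) (sym (+-suc n s))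
        (blocks-unique t {suc n} {suc k} rest (drop-first-block t long) s<t)

    -- The converse of `blocks-unique`: a repetition in the code is a repetition in `u`, final mark
    -- included. This carries unioccurrence from `u` to the code.
    blocks-glue : ∀ t {n k} → (∀ {s} → s < suc t → block (k + s) ≡ block (n + s)) →
                  ∃[ D ] pos k ⟦ D ⟧ ≡ pos n ⟦ D ⟧ × pos (n + suc t) + m ≡ pos n + D
    blocks-glue zero {n} {k} h = len n + m ,
      trans (cong (λ l → pos k ⟦ l + m ⟧) (sym (block-len first))) first ,
      trans (cong (_+ m) (trans (cong pos (+-comm n 1)) (pos-suc n))) (+-assoc (pos n) (len n) m)
      where
      first : block k ≡ block n
      first = subst₂ (λ i j → block i ≡ block j) (+-identityʳ k) (+-identityʳ n) (h (s≤s z≤n))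
    blocks-glue (suc t) {n} {k} h with blocks-glue t {suc n} {suc k}
      (λ {s} s<t → subst₂ (λ i j → block i ≡ block j) (+-suc k s) (+-suc n s) (h (s≤s s<t)))
    ... | D , e , len≡ = len n + D , (begin
        pos k ⟦ len n + D ⟧                       ≡⟨ slice-+ (pos k) (len n) D ⟩
        pos k ⟦ len n ⟧ ++ (pos k + len n) ⟦ D ⟧  ≡⟨ cong₂ _++_ (block-head {n} {k} first) (cong (_⟦ D ⟧) shifted) ⟩
        pos n ⟦ len n ⟧ ++ pos (suc k) ⟦ D ⟧      ≡⟨ cong (pos n ⟦ len n ⟧ ++_) (trans e (cong (_⟦ D ⟧) (pos-suc n))) ⟩
        pos n ⟦ len n ⟧ ++ (pos n + len n) ⟦ D ⟧  ≡⟨ slice-+ (pos n) (len n) D ⟨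
        pos n ⟦ len n + D ⟧                       ∎) ,
      (begin
        pos (n + suc (suc t)) + m     ≡⟨ cong (λ i → pos i + m) (+-suc n (suc t)) ⟩
        pos (suc n + suc t) + m       ≡⟨ len≡ ⟩
        pos (suc n) + D               ≡⟨ cong (_+ D) (pos-suc n) ⟩
        pos n + len n + D             ≡⟨ +-assoc (pos n) (len n) D ⟩
        pos n + (len n + D)           ∎)
      where
      open ≡-Reasoning
      first : block k ≡ block n
      first = subst₂ (λ i j → block i ≡ block j) (+-identityʳ k) (+-identityʳ n) (h (s≤s z≤n))
      shifted : pos k + len n ≡ pos (suc k)
      shifted = trans (cong (pos k +_) (sym (block-len first))) (sym (pos-suc k))

    -- The mark ending block `n` is reflected to a mark at `q + r`, at distance `len n` before
    -- `pos (suc b)`. It cannot lie strictly after `pos b`, by the gap of `b`; nor before it, since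
    -- then the mark `pos b` would be reflected into the gap of `n`.
    block-mirror : ∀ {n b q r} → q ⟦ len n + m + r ⟧ ≡ Θ (pos n ⟦ len n + m + r ⟧) →
                   q + (len n + m + r) ≡ pos (suc b) + m → block n ≡ block b × q + r ≡ pos b
    block-mirror {n} {b} {q} {r} e end = sym (begin
        block b                            ≡⟨ cong (λ l → pos b ⟦ l + m ⟧) len≡ ⟩
        pos b ⟦ len n + m ⟧                ≡⟨ cong (_⟦ len n + m ⟧) pos≡ ⟨
        (q + r) ⟦ len n + m ⟧              ≡⟨ slice-mirror e 0 (len n + m) r refl ⟩
        Θ ((pos n + 0) ⟦ len n + m ⟧)      ≡⟨ cong (λ i → Θ (i ⟦ len n + m ⟧)) (+-identityʳ (pos n)) ⟩
        Θ (block n)                        ≡⟨ block-palindrome n ⟩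
        block n                            ∎) , pos≡
      where
      open ≡-Reasoning
      p = q + r
      end′ : p + len n ≡ pos (suc b)
      end′ = +-cancelʳ-≡ m _ _ (trans (shuffle q r (len n) m) end)
        where
        shuffle : ∀ q r l m → q + r + l + m ≡ q + (l + m + r)
        shuffle q r l m = trans (+-assoc (q + r) l m)
          (trans (+-assoc q r (l + m)) (cong (q +_) (+-comm r (l + m))))
      p-mark : Mark p
      p-mark = mark-Θ (slice-mirror e (len n) m r refl) (pos-suc-mark n)
      pos≡ : p ≡ pos b
      pos≡ with ≤-total (pos b) p
      ... | inj₁ b≤p = gap-start b p-mark b≤p
        (≤-trans (m<m+n p (len>0 n)) (≤-reflexive end′))
      ... | inj₂ p≤b with ≤⇒+ p≤b
      ...   | zero  , b≡ = sym (trans b≡ (+-identityʳ p))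
      ...   | suc t , b≡ with ≤⇒+ (+-cancelˡ-< p (suc t) (len n) (≤-trans (≤-reflexive (cong suc (sym b≡)))
                                    (≤-trans (pos-mono-< (n<1+n b)) (≤-reflexive (sym end′)))))
      ...     | c , len≡′ = contradiction
        (mark-Θ mirrored (subst Mark b≡ (pos-X b)))
        (gap n {suc c} (s≤s z≤n) (≤-trans (s≤s (s≤s (m≤n+m c t))) (≤-reflexive (sym len≡′))))
        where
        -- Distance `suc t` after `p` is reflected to distance `suc c` after `pos n`, the two adding
        -- up to `len n`.
        shape : suc c + m + (suc t + r) ≡ len n + m + r
        shape = trans (regroup c t m r) (cong (λ l → l + m + r) (sym len≡′))
        mirrored : (pos n + suc c) ⟦ m ⟧ ≡ Θ ((p + suc t) ⟦ m ⟧)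
        mirrored = trans (sym (involutive ((pos n + suc c) ⟦ m ⟧))) (cong Θ (trans
          (sym (slice-mirror e (suc c) m (suc t + r) shape))
          (cong (_⟦ m ⟧) (trans (cong (q +_) (+-comm (suc t) r)) (sym (+-assoc q r (suc t)))))))
      len≡ : len b ≡ len n
      len≡ = +-cancelˡ-≡ (pos b) _ _ (trans (sym (pos-suc b)) (trans (sym end′) (cong (_+ len n) pos≡)))

    -- Each step removes the first block of one word and the last block of its mirror image, so `q`
    -- stays fixed while `n` advances. With `q` at `pos n` and `b` equal to `n` it says that the
    -- code of a palindrome is a palindrome.
    blocks-mirror : ∀ t {n b q N} → q ⟦ N ⟧ ≡ Θ (pos n ⟦ N ⟧) → q + N ≡ pos (b + t) + m →
                    pos (n + t) + m ≤ pos n + N →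
                    ∀ {s s′} → suc (s + s′) ≡ t → block (n + s) ≡ block (b + s′)
    blocks-mirror (suc t) {n} {b} {q} {N} e end long {s} {s′} s+s′ with ≤⇒+ (first-block-fits t {n} long)
    ... | r , refl = go s s+s′
      where
      first : block n ≡ block (b + t) × q + r ≡ pos (b + t)
      first = block-mirror e (trans end (cong (λ i → pos i + m) (+-suc b t)))
      rest : q ⟦ m + r ⟧ ≡ Θ (pos (suc n) ⟦ m + r ⟧)
      rest = subst₂ (λ i j → i ⟦ m + r ⟧ ≡ Θ (j ⟦ m + r ⟧)) (+-identityʳ q) (sym (pos-suc n))
        (slice-mirror e (len n) (m + r) 0 (trans (+-identityʳ _) (sym (+-assoc (len n) m r))))
      end′ : q + (m + r) ≡ pos (b + t) + m
      end′ = trans (cong (q +_) (+-comm m r)) (trans (sym (+-assoc q r m)) (cong (_+ m) (proj₂ first)))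
      go : ∀ s → suc (s + s′) ≡ suc t → block (n + s) ≡ block (b + s′)
      go zero    refl = trans (cong block (+-identityʳ n)) (proj₁ first)
      go (suc s) eq   = trans (cong block (+-suc n s))
        (blocks-mirror t {suc n} {b} {q} rest end′ (drop-first-block t long) {s} {s′} (suc-injective eq))

-- The coded word

module _ (B : FiniteAlphabet) where

  reverse-anti : IsInvolutiveAntimorphism B reverse
  reverse-anti = record { involutive = reverse-involutive ; anti = reverse-++ }

  module _ (v : InfiniteWord B) where

    open Slices B v
    open Palindromes B reverse reverse-anti

    reverse-slice : ∀ t {c d} → (∀ {s s′} → suc (s + s′) ≡ t → v (c + s) ≡ v (d + s′)) →
                    reverse (c ⟦ t ⟧) ≡ d ⟦ t ⟧
    reverse-slice zero    h = refl
    reverse-slice (suc t) {c} {d} h = begin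
      reverse (c ⟦ suc t ⟧)             ≡⟨ cong reverse (slice-suc c t) ⟩
      reverse (v c ∷ suc c ⟦ t ⟧)       ≡⟨ unfold-reverse (v c) (suc c ⟦ t ⟧) ⟩
      reverse (suc c ⟦ t ⟧) ++ [ v c ]  ≡⟨ cong₂ (λ x a → x ++ [ a ])
        (reverse-slice t λ {s} e → trans (cong v (sym (+-suc c s))) (h (cong suc e)))
        (trans (cong v (sym (+-identityʳ c))) (h refl)) ⟩
      d ⟦ t ⟧ ++ [ v (d + t) ]          ≡⟨ slice-∷ʳ d t ⟨
      d ⟦ suc t ⟧                       ∎
      where open ≡-Reasoning

    -- Induction on the length from the empty word, whose defect is 0: the suffix does not occur in
    -- the word without its last letter, so `defect-newPal` keeps the defect unchanged.
    rich-from-suffixes :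
      (∀ a n → ∃₂ λ c t → a ≤ c × c + suc t ≡ a + suc n × reverse (c ⟦ suc t ⟧) ≡ c ⟦ suc t ⟧ ×
               (∀ {k} → a ≤ k → k < c → k ⟦ suc t ⟧ ≢ c ⟦ suc t ⟧)) →
      RichInfinite B reverse v
    rich-from-suffixes suffix w (a , occ-a) = subst (Rich B reverse) occ-a (rich (length w))
      where
      rich : ∀ n → Rich B reverse (a ⟦ n ⟧)
      rich zero    = refl
      rich (suc n) = trans (cong (defect B reverse) (slice-∷ʳ a n))
        (trans (extend (suffix a n)) (rich n))
        where
        extend : _ → defect B reverse (a ⟦ n ⟧ ++ [ v (a + n) ]) ≡ defect B reverse (a ⟦ n ⟧)
        extend (c , t , a≤c , end , pal , once) = defect-newPal (a ⟦ n ⟧) (v (a + n))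
          (pal , subst (c ⟦ suc t ⟧ ⊑_) (slice-∷ʳ a n) (slice-⊑ a≤c (≤-reflexive end)) , λ s⊑ →
            let b , b≤ , e = ⊑-slice s⊑
                l≡ = slice-length c (suc t)
            in once (m≤m+n a b)
                 (+-cancelʳ-< (suc t) (a + b) c (begin-strict
                   a + b + suc t       ≡⟨ +-assoc a b (suc t) ⟩
                   a + (b + suc t)     ≤⟨ +-monoʳ-≤ a (≤-trans (≤-reflexive (cong (b +_) (sym l≡))) b≤) ⟩
                   a + n               <⟨ +-monoʳ-< a (n<1+n n) ⟩
                   a + suc n           ≡⟨ end ⟨
                   c + suc t           ∎))
                 (trans (cong ((a + b) ⟦_⟧) (sym l≡)) e))
          where open ≤-Reasoning

module Coding (A : FiniteAlphabet) (Θ : Word A → Word A)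
  (Θ-anti : IsInvolutiveAntimorphism A Θ) (u : InfiniteWord A) (m M : ℕ)
  (marked : Marks (Blocks.Mark A Θ Θ-anti u m) M)
  (block-palindrome : Blocks.PalindromicBlocks A Θ Θ-anti u m marked)
  (windows : Windowed A u) where

  open FiniteAlphabet A using (_≟ʷ_)
  open Slices A u
  open Blocks A Θ Θ-anti u m
  open Marks marked
  open Decode marked block-palindrome

  -- A block has at most `M + m` letters, so each block recurs at a mark before `size`. The index of
  -- a mark never exceeds its position, hence all codes are below `size`.
  size : ℕ
  size = proj₁ (windows (M + m))

  -- A block is coded by the index of its first occurrence in u, so that equal
  -- blocks get equal codes.
  code : ∀ n → ∃[ j ] j < size × block j ≡ block n × (∀ {t} → t < j → block t ≢ block n)
  code n with proj₂ (windows (M + m)) (pos n) 0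
  ... | p , _ , p<size , e with pos-onto (mark-cong (sym (slice-take e (m≤n+m m M))) (pos-X n))
  ... | k , refl with block-unique {n} {k} e (+-monoˡ-≤ m (len≤ n))
  ... | k≡n with next (λ t → block t ≟ʷ block n) 0 k k≡n
  ... | j , _ , same , first = j ,
    ≤-<-trans (≮⇒≥ λ k<j → first z≤n k<j k≡n) (≤-<-trans (n≤pos k) p<size) ,
    same , first z≤n

  B : FiniteAlphabet
  B = record { Letter = Fin size ; size = size ; enum = ↔-refl }

  v : InfiniteWord B
  v n = fromℕ< (proj₁ (proj₂ (code n)))

  v-cong : ∀ {n k} → block n ≡ block k → v n ≡ v k
  v-cong {n} {k} e with code n | code k
  ... | i , i< , i≡ , i-first | j , j< , j≡ , j-first =
    Fin.fromℕ<-cong i j (≤-antisym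
      (≮⇒≥ λ j<i → i-first j<i (trans j≡ (sym e)))
      (≮⇒≥ λ i<j → j-first i<j (trans i≡ e))) i< j<

  block-v : ∀ n → block (toℕ (v n)) ≡ block n
  block-v n with code n
  ... | j , j< , j≡ , _ = trans (cong block (Fin.toℕ-fromℕ< j<)) j≡

  v-injective : ∀ {n k} → v n ≡ v k → block n ≡ block k
  v-injective {n} {k} e = trans (sym (block-v n)) (trans (cong (block ∘ toℕ) e) (block-v k))

  -- The block without its last `m` letters, with which the next block begins.
  φ₁ : Letter B → Word A
  φ₁ b = pos (toℕ b) ⟦ len (toℕ b) ⟧

  φ : Word B → Word A
  φ = concatMap φ₁

  φ-morphism : IsMorphism B A φ
  φ-morphism = record
    { isMagmaHomomorphism = record
      { isRelHomomorphism = record { cong = cong φ }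
      ; homo = concatMap-++ φ₁
      }
    ; ε-homo = refl
    }

  φ₁-v : ∀ n → φ₁ (v n) ≡ pos n ⟦ len n ⟧
  φ₁-v n = trans (cong (pos k ⟦_⟧) (block-len {n} {k} (block-v n))) (block-head {n} {k} (block-v n))
    where
    k = toℕ (v n)

  φ-prefix : ∀ n → φ (slice B v 0 n) ≡ 0 ⟦ pos n ⟧
  φ-prefix zero    = cong (0 ⟦_⟧) (sym pos-0)
  φ-prefix (suc n) = begin
    φ (slice B v 0 (suc n))               ≡⟨ cong φ (Slices.slice-∷ʳ B v 0 n) ⟩
    φ (slice B v 0 n ++ [ v n ])          ≡⟨ concatMap-++ φ₁ (slice B v 0 n) [ v n ] ⟩
    φ (slice B v 0 n) ++ φ₁ (v n) ++ []  
      ≡⟨ cong₂ _++_ (φ-prefix n) (trans (++-identityʳ (φ₁ (v n))) (φ₁-v n)) ⟩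
    0 ⟦ pos n ⟧ ++ pos n ⟦ len n ⟧        ≡⟨ slice-+ 0 (pos n) (len n) ⟨
    0 ⟦ pos n + len n ⟧                   ≡⟨ cong (0 ⟦_⟧) (pos-suc n) ⟨
    0 ⟦ pos (suc n) ⟧                     ∎
    where open ≡-Reasoning

  image : IsImage B A φ v u
  image = (λ n → subst (λ w → OccursAt A u w 0) (sym (φ-prefix n)) (occursAt 0 (pos n))) ,
    λ n → n , ≤-trans (n≤pos n) (≤-reflexive
      (trans (sym (slice-length 0 (pos n))) (cong length (sym (φ-prefix n)))))

  v-windowed : Windowed B v
  -- `n` blocks advance by at most `n * M` letters, and the mark ending the last one takes `m` more.
  -- The bound `N` also serves for `v`, as indices advance no faster than positions.
  v-windowed n with windows (n * M + m)
  ... | N , h = N , window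
    where
    window : ∀ i k → ∃[ j ] k ≤ j × j < k + N × slice B v j n ≡ slice B v i n
    window i k with h (pos i) (pos k)
    ... | p , k≤p , p< , e with pos-onto (mark-cong (sym (slice-take e (m≤n+m m (n * M)))) (pos-X i))
    ... | j , refl = j , pos-cancel-≤ k≤p , pos-cancel-< (≤-trans p< (pos-+ k N)) ,
      Slices.slice-cong B v {j} {i} λ s<n → v-cong (blocks-unique n e (begin
        pos (i + n) + m         ≤⟨ +-monoˡ-≤ m (pos-+-≤ i n) ⟩
        pos i + n * M + m       ≡⟨ +-assoc (pos i) (n * M) m ⟩
        pos i + (n * M + m)     ∎) s<n)
      where open ≤-Reasoning

  v-uniformlyRecurrent : UniformlyRecurrent B v
  v-uniformlyRecurrent = Occurrences.FromWindows.uniformlyRecurrent B v v-windowed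

  -- The hypothesis lives in `u` but is indexed by blocks. `blocks-mirror` makes the suffix a
  -- palindrome of `v`, and `blocks-glue` would turn an earlier occurrence in `v` into one in `u`.
  v-rich : (∀ {i j} → i < j → ∃₂ λ c N → i ≤ c × c < j × pos c + N ≡ pos j + m ×
             Θ (pos c ⟦ N ⟧) ≡ pos c ⟦ N ⟧ × (∀ {k} → i ≤ k → k < c → pos k ⟦ N ⟧ ≢ pos c ⟦ N ⟧)) →
           RichInfinite B reverse v
  v-rich suffix = rich-from-suffixes B v λ a n → decode a n (suffix (m<m+n a (s≤s z≤n)))
    where
    decode : ∀ a n → _ → _
    decode a n (c , N , a≤c , c< , end , pal , once) with ≤⇒+ c<
    ... | t , j≡ = c , t , a≤c , j≡′ ,
      reverse-slice B v (suc t) (λ {s} {s′} e →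
        v-cong (blocks-mirror (suc t) {c} {c} (sym pal) end′ (≤-reflexive (sym end′)) {s} {s′} e)) ,
      λ {k} a≤k k<c e →
        let D , glued , end-D = blocks-glue t {c} {k} λ s<t →
              v-injective (Slices.slice-letter B v {k} {c} e s<t)
            D≡N : D ≡ N
            D≡N = +-cancelˡ-≡ (pos c) D N (trans (sym end-D) (sym end′))
        in once a≤k k<c (subst (λ d → pos k ⟦ d ⟧ ≡ pos c ⟦ d ⟧) D≡N glued)
      where
      j≡′ : c + suc t ≡ a + suc n
      j≡′ = trans (+-suc c t) (sym j≡)
      end′ : pos c + N ≡ pos (c + suc t) + m
      end′ = trans end (cong (λ i → pos i + m) (sym j≡′))

-- From a factor of maximal defect to the rich preimage

module _ (A : FiniteAlphabet) (Θ : Word A → Word A)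
  (Θ-anti : IsInvolutiveAntimorphism A Θ) (u : InfiniteWord A) where

  open Slices A u
  open Mirror Θ Θ-anti

  RichImage : Set₁
  RichImage = Σ[ B ∈ FiniteAlphabet ] Σ[ φ ∈ (Word B → Word A) ] Σ[ v ∈ InfiniteWord B ]
    (IsMorphism B A φ × UniformlyRecurrent B v × IsImage B A φ v u × RichInfinite B reverse v)

  -- Defects are integers, so a factor whose defect exceeds `pred d` reaches the supremum `d`.
  defect-attained : FiniteDefect A Θ u → ∃[ w₀ ] IsFactor A u w₀ ×
    (∀ x → IsFactor A u x → defect A Θ x ℤ.≤ defect A Θ w₀)
  defect-attained (d , upper , least)
    with least (ℤ.pred d) (ℤ.i≤pred[j]⇒i<j ℤ.≤-refl)
  ... | w₀ , factor , d-1< = w₀ , factor , λ x x∈ → ℤ.≤-trans (upper x x∈)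
    (subst (ℤ._≤ defect A Θ w₀) (ℤ.suc-pred d) (ℤ.i<j⇒suc[i]≤j d-1<))

  module _ (w₀ : Word A) (maximal : ∀ x → IsFactor A u x → defect A Θ x ℤ.≤ defect A Θ w₀)
           (m : ℕ) (w₀⊑w : w₀ ⊑ 0 ⟦ suc m ⟧) (w₀⊑Θw : w₀ ⊑ Θ (0 ⟦ suc m ⟧)) where

    open Maximal w₀ maximal
    open Blocks A Θ Θ-anti u (suc m)

    w₀⊑mark : ∀ {i} → Mark i → w₀ ⊑ i ⟦ suc m ⟧
    w₀⊑mark (inj₁ e) = subst (w₀ ⊑_) (sym e) w₀⊑w
    w₀⊑mark (inj₂ e) = subst (w₀ ⊑_) (sym e) w₀⊑Θw

    MarkedSuffix : ℕ → ℕ → Set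
    MarkedSuffix i j = ∃₂ λ p N → i ≤ p × p < j × Mark p × p + N ≡ j + suc m ×
      Θ (p ⟦ N ⟧) ≡ p ⟦ N ⟧ × (∀ {k} → i ≤ k → k < p → k ⟦ N ⟧ ≢ p ⟦ N ⟧)

    markedSuffix : ∀ {i j} → i < j → Mark i → Mark j → MarkedSuffix i j
    markedSuffix {i} {j} i<j Xi Xj = describe (ups-return m i<j (w₀⊑mark Xi) (mark-relate Xi Xj))
      where
      describe : Σ[ U ∈ Ups i (j + suc m) ] Ups.start U < j × Ups.start U ⟦ suc m ⟧ ≡ Θ (j ⟦ suc m ⟧) →
                 MarkedSuffix i j
      describe (U , start<j , start-Θ) =
        start , len , i≤start , start<j , mark-Θ start-Θ Xj , end , palindrome , unioccurrent
        where
        open Ups U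

    module _ {M : ℕ} (marked : Marks Mark M) where

      open Marks marked

      block-palindrome : PalindromicBlocks marked
      block-palindrome n = whole
        (markedSuffix {pos n} {pos (suc n)} (pos-mono-< (n<1+n n)) (pos-X n) (pos-X (suc n)))
        where
        whole : MarkedSuffix (pos n) (pos (suc n)) →
                Θ (pos n ⟦ len n + suc m ⟧) ≡ pos n ⟦ len n + suc m ⟧
        whole (p , N , n≤p , p< , Xp , end , pal , _) = subst₂ (λ i l → Θ (i ⟦ l ⟧) ≡ i ⟦ l ⟧) p≡ N≡ pal
          where
          -- From `pos n` up to but excluding `pos (suc n)` the only mark is `pos n`, so the
          -- palindromic suffix is the whole block.
          p≡ : p ≡ pos n
          p≡ = gap-start n Xp n≤p p<
          N≡ : N ≡ len n + suc m
          N≡ = +-cancelˡ-≡ (pos n) N (len n + suc m) (trans (cong (_+ N) (sym p≡))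
            (trans end (trans (cong (_+ suc m) (pos-suc n)) (+-assoc (pos n) (len n) (suc m)))))

      CodeSuffix : ℕ → ℕ → Set
      CodeSuffix i j = ∃₂ λ c N → i ≤ c × c < j × pos c + N ≡ pos j + suc m ×
        Θ (pos c ⟦ N ⟧) ≡ pos c ⟦ N ⟧ × (∀ {k} → i ≤ k → k < c → pos k ⟦ N ⟧ ≢ pos c ⟦ N ⟧)

      code-suffix : ∀ {i j} → i < j → CodeSuffix i j
      code-suffix {i} {j} i<j = decode
        (markedSuffix {pos i} {pos j} (pos-mono-< i<j) (pos-X i) (pos-X j))
        where
        decode : MarkedSuffix (pos i) (pos j) → CodeSuffix i j
        decode (p , N , i≤p , p<j , Xp , end , pal , once) = locate (pos-onto Xp)
          where
          locate : ∃[ c ] p ≡ pos c → CodeSuffix i j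
          locate (c , refl) = c , N , pos-cancel-≤ i≤p , pos-cancel-< p<j , end , pal ,
            λ i≤k k<c → once (pos-mono-≤ i≤k) (pos-mono-< k<c)

      coded : Windowed A u → RichImage
      coded windows = B , φ , v , φ-morphism , v-uniformlyRecurrent , image , v-rich code-suffix
        where
        open Coding A Θ Θ-anti u (suc m) M marked block-palindrome windows

    richImage : Windowed A u → RichImage
    richImage windows with windows (suc m)
    -- Looking from `suc p` on makes the next copy of `w` strictly later than `p`, and `M` then
    -- bounds the distance between consecutive marks.
    ... | M , window = coded {M} (marks mark? (inj₁ refl) λ p →
      let j , p<j , j< , e = window 0 (suc p) in j , p<j , s≤s⁻¹ j< , inj₁ e) windows

theorem2 : (A : FiniteAlphabet) (Θ : Word A → Word A) →
    IsInvolutiveAntimorphism A Θ →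
    (u : InfiniteWord A) →
    UniformlyRecurrent A u →
    FiniteDefect A Θ u →
    Σ[ B ∈ FiniteAlphabet ] Σ[ φ ∈ (Word B → Word A) ] Σ[ v ∈ InfiniteWord B ]
    (IsMorphism B A φ ×
    UniformlyRecurrent B v ×
    IsImage B A φ v u ×
    RichInfinite B reverse v)
theorem2 A Θ Θ-anti u ur finite = fromMaximal (defect-attained A Θ Θ-anti u finite)
  where
  open Slices A u
  MaximalFactor : Word A → Set
  MaximalFactor w₀ = IsFactor A u w₀ × (∀ x → IsFactor A u x → defect A Θ x ℤ.≤ defect A Θ w₀)
  fromSeed : ∀ {w₀} → MaximalFactor w₀ → ∃[ m ] w₀ ⊑ 0 ⟦ suc m ⟧ × w₀ ⊑ Θ (0 ⟦ suc m ⟧) →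
             RichImage A Θ Θ-anti u
  fromSeed {w₀} (_ , maximal) (m , w₀⊑w , w₀⊑Θw) = richImage A Θ Θ-anti u w₀ maximal m w₀⊑w w₀⊑Θw
    (Occurrences.FromReturnWords.windowed A u ur)
  fromMaximal : ∃ MaximalFactor → RichImage A Θ Θ-anti u
  fromMaximal (w₀ , factor , maximal) = fromSeed (factor , maximal)
    (seed Θ Θ-anti (proj₁ ur) w₀ factor maximal)
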